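{- Fix $k\in\mathbb{N}$. Suppose that for every $n\in\mathbb{N}$ we are given a deterministic adaptive query procedure on $[n]$, i.e., functions $\mathsf{Pair}_i:(\binom{[n]}{2}\times[0,\infty))^{i-1}\to\binom{[n]}{2}$ for $i=1,\ldots,m(n)$, where $m(n)=o(n^{(k+1)/k})$ as $n\to\infty$. Then for every $n$ there exist answers to the queries, namely a sequence of pairs $\{a_1,b_1\},\ldots,\{a_{m},b_{m}\}$ ($m=m(n)$) and values $w(a_i,b_i)\in\{1,\ldots,k\}$ with $\{a_i,b_i\}=\mathsf{Pair}_i\big((\{a_1,b_1\},w(a_1,b_1)),\ldots,(\{a_{i-1},b_{i-1}\},w(a_{i-1},b_{i-1}))\big)$ for all $i$, together with two metrics $\overline{d},\underline{d}:[n]\times[n]\to[0,k+1]$ on $[n]$, such that, writing $E=\{\{a_i,b_i\}:i\le m\}$: (a) $\overline{d}(u,v)=\underline{d}(u,v)=w(u,v)$ for every $\{u,v\}\in E$; (b) $\overline{d}(x,y)=k+1$ for all $(x,y)\in([n]\times[n])\setminus X_n$ for some $X_n\subseteq[n]\times[n]$ with $|X_n|=o(n^2)$; (c) $\underline{d}(x,y)=\tfrac12$ for all $(x,y)\in([n]\times[n])\setminus Y_n$ for some $Y_n\subseteq[n]\times[n]$ with $|Y_n|=o(n^2)$, where the $o(\cdot)$ are as $n\to\infty$.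
   Context: $[n]=\{1,\ldots,n\}$ and $\binom{[n]}{2}$ is the set of unordered pairs of distinct elements of $[n]$. $\mathsf{Pair}_1$ is a fixed pair (a function of no arguments). The procedure is adaptive: each queried pair is a function of the previously queried pairs and the answers received. -}

module Defs where

open import Data.Nat using (ℕ; zero; suc; _+_; _*_; _^_; _<_; _≤_)
open import Data.Bool using (Bool; true; false; if_then_else_)
open import Data.Fin using (Fin; toℕ; inject)
open import Data.List using (List; map; allFin)
open import Data.Nat.ListAction using (sum)
open import Data.Vec using (Vec; tabulate)
open import Data.Product using (Σ; Σ-syntax; ∃-syntax; _×_; _,_; proj₁)
open import Data.Integer using (+_)
open import Data.Rational using (ℚ; _/_; 0ℚ; ½) renaming (_+_ to _+ℚ_; _≤_ to _≤ℚ_; _<_ to _<ℚ_)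
open import Relation.Binary.PropositionalEquality using (_≡_; _≢_)

toℚ : ℕ → ℚ
toℚ n = (+ n) / 1

-- unordered pairs of distinct elements of [n], represented canonically as (a , b) with a < b
UPair : ℕ → Set
UPair n = Σ[ ab ∈ Fin n × Fin n ] (Data.Fin._<_ (proj₁ ab) (Data.Product.proj₂ ab))

-- a deterministic adaptive query procedure with m queries on [n]:
-- Pair i maps the history of the previous i queries (pair, answer) to the next pair.
-- Answers are taken rational.
Procedure : ℕ → ℕ → Set
Procedure n m = (i : Fin m) → Vec (UPair n × ℚ) (toℕ i) → UPair n

history : ∀ {n m} → (Fin m → UPair n) → (Fin m → ℕ) → (i : Fin m) → Vec (UPair n × ℚ) (toℕ i)
history p w i = tabulate (λ j → p (inject {i = i} j) , toℚ (w (inject {i = i} j)))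

record IsMetric (n : ℕ) (d : Fin n → Fin n → ℚ) : Set where
  field
    diag      : ∀ x → d x x ≡ 0ℚ
    positive  : ∀ x y → x ≢ y → 0ℚ <ℚ d x y
    symmetric : ∀ x y → d x y ≡ d y x
    triangle  : ∀ x y z → d x z ≤ℚ (d x y +ℚ d y z)

card : ∀ {n} → (Fin n → Fin n → Bool) → ℕ
card {n} X = sum (map (λ x → sum (map (λ y → if X x y then 1 else 0) (allFin n))) (allFin n))

-- f = o(g) as n → ∞, for ℕ-valued sequences: ∀ ε = 1/c > 0, eventually f n ≤ ε g n
LittleO : (ℕ → ℕ) → (ℕ → ℕ) → Set
LittleO f g = ∀ c → 0 < c → ∃[ N ] (∀ n → N ≤ n → c * f n ≤ g n)

-- m(n) = o(n^{(k+1)/k}), i.e. ∀ c > 0, eventually (c * m n)^k ≤ n^(k+1)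
SubCritical : ℕ → (ℕ → ℕ) → Set
SubCritical k m = ∀ c → 0 < c → ∃[ N ] (∀ n → N ≤ n → (c * m n) ^ k ≤ n ^ (k + 1))

record Answer (k n m : ℕ) (Pair : Procedure n m) : Set where
  field
    p          : Fin m → UPair n
    w          : Fin m → ℕ
    w-range    : ∀ i → 1 ≤ w i × w i ≤ k
    consistent : ∀ i → p i ≡ Pair i (history p w i)
    dbar       : Fin n → Fin n → ℚ
    dund       : Fin n → Fin n → ℚ
    dbar-metric : IsMetric n dbar
    dund-metric : IsMetric n dund
    dbar-range : ∀ x y → 0ℚ ≤ℚ dbar x y × dbar x y ≤ℚ toℚ (k + 1)
    dund-range : ∀ x y → 0ℚ ≤ℚ dund x y × dund x y ≤ℚ toℚ (k + 1)
    dbar-edge  : ∀ i → dbar (proj₁ (proj₁ (p i))) (Data.Product.proj₂ (proj₁ (p i))) ≡ toℚ (w i)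
    dund-edge  : ∀ i → dund (proj₁ (proj₁ (p i))) (Data.Product.proj₂ (proj₁ (p i))) ≡ toℚ (w i)
    X          : Fin n → Fin n → Bool
    X-spec     : ∀ x y → X x y ≡ false → dbar x y ≡ toℚ (k + 1)
    Y          : Fin n → Fin n → Bool
    Y-spec     : ∀ x y → Y x y ≡ false → dund x y ≡ ½

{-# OPTIONS --safe #-}
-- Answer the queries so as to keep an integer metric d (initially k + 1 off the diagonal) that never
-- changes on queried pairs.  The level of a vertex is the largest j < k for which it has been queried at
-- least D ^ j times, and its potential is f x = max_u (level u - d u x).  A query {a , b} is answered by
-- min (d a b) (1 + max (f a) (f b)), and d is updated by adding this edge.  Since f is 1-Lipschitz, a new
-- edge creates no shortcut between previously queried pairs; since a vertex that receives an edge of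
-- weight w < k has level below w, it has at most D ^ w such edges, so d-balls of radius r < k have at
-- most (2 D) ^ r points.  Hence d x y = k + 1 for most pairs, which gives the upper metric.
--
-- For the lower metric, min (d x y) (1/2 + max (f x) (f y)) is a metric, equal to 1/2 for most pairs
-- because few vertices have positive potential; it is raised by 1/2 on the queried pairs and on the few
-- pairs onto which the triangle inequality propagates this raise.  All bounds are o(n ^ 2) when
-- D = o(n ^ (1/k)) and m = o(n D).
module Submission where

open import Defs
open import Data.Bool using (Bool; false; if_then_else_)
open import Data.Empty using (⊥-elim)
open import Data.Fin using (Fin; zero; suc; toℕ; fromℕ<)
import Data.Fin as Fin
import Data.Fin.Properties as Finₚ
open import Data.Integer using (+≤+; +<+) renaming (+_ to pos)
import Data.Integer as ℤ
import Data.Integer.Properties as ℤₚ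
import Data.Integer.Tactic.RingSolver as ℤ-Solver
open import Data.List using (tabulate; allFin)
import Data.List as List
import Data.List.Properties as Listₚ
open import Data.Nat
open import Data.Nat.Induction using (<-rec)
open import Data.Nat.ListAction using () renaming (sum to sumᴸ)
open import Data.Nat.Properties
open import Data.Nat.Tactic.RingSolver using (solve-∀)
open import Data.Product using (Σ-syntax; ∃-syntax; ∃₂; _×_; _,_; proj₁; proj₂)
open import Data.Rational using (ℚ; 0ℚ; ½; fromℚᵘ; toℚᵘ) renaming (_+_ to _+ℚ_; _≤_ to _≤ℚ_; _<_ to _<ℚ_)
import Data.Rational.Properties as ℚₚ
open import Data.Rational.Unnormalised as ℚᵘ using (mkℚᵘ; *≤*; *<*; *≡*)
import Data.Rational.Unnormalised.Properties as ℚᵘₚ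
open import Data.Sum using (_⊎_; inj₁; inj₂; swap)
open import Data.Vec using ([]; _∷_)
open import Function using (_∘_; id)
open import Relation.Binary.PropositionalEquality
open import Relation.Nullary using (Dec; yes; no; does; ¬_)
open import Relation.Nullary.Decidable using (¬?; _⊎-dec_; _×-dec_)
open import Relation.Unary using (Decidable)

open import Algebra.Properties.Semiring.Sum +-*-semiring using (sum; sum-syntax; sum-cong-≗; sum-replicate-zero; ∑-distrib-+; ∑-comm; *-distribˡ-sum; *-distribʳ-sum)

-- Finite sums and maxima

private variable
  n : ℕ

sum-mono : {f g : Fin n → ℕ} → (∀ i → f i ≤ g i) → sum f ≤ sum g
sum-mono {zero}  h = z≤n
sum-mono {suc n} h = +-mono-≤ (h zero) (sum-mono (h ∘ suc))

term≤sum : (f : Fin n → ℕ) (i : Fin n) → f i ≤ sum f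
term≤sum f zero    = m≤m+n _ _
term≤sum f (suc i) = ≤-trans (term≤sum (f ∘ suc) i) (m≤n+m _ _)

sum-const : ∀ n c → sum {n} (λ _ → c) ≡ n * c
sum-const zero    c = refl
sum-const (suc n) c = cong (c +_) (sum-const n c)

-- Defined through `does`, so that a double sum of `𝟙` is definitionally the sum attached to the
-- Boolean set given by `does`.
𝟙 : {A : Set} → Dec A → ℕ
𝟙 A? = if does A? then 1 else 0

𝟙-yes : {A : Set} (A? : Dec A) → A → 𝟙 A? ≡ 1
𝟙-yes (yes _) a = refl
𝟙-yes (no ¬a) a = ⊥-elim (¬a a)

𝟙-no : {A : Set} (A? : Dec A) → ¬ A → 𝟙 A? ≡ 0
𝟙-no (yes a) ¬a = ⊥-elim (¬a a)
𝟙-no (no _)  ¬a = refl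

𝟙-bound : {A : Set} (A? : Dec A) {b : ℕ} → (A → 1 ≤ b) → 𝟙 A? ≤ b
𝟙-bound (yes a) h = h a
𝟙-bound (no _)  h = z≤n

𝟙≤1 : {A : Set} (A? : Dec A) → 𝟙 A? ≤ 1
𝟙≤1 A? = 𝟙-bound A? (λ _ → ≤-refl)

𝟙-mono : {A B : Set} (A? : Dec A) (B? : Dec B) → (A → B) → 𝟙 A? ≤ 𝟙 B?
𝟙-mono A? B? A⇒B = 𝟙-bound A? λ a → ≤-reflexive (sym (𝟙-yes B? (A⇒B a)))

δ : Fin n → Fin n → ℕ
δ a x = 𝟙 (a Fin.≟ x)

δ-refl : (a : Fin n) → δ a a ≡ 1
δ-refl a = 𝟙-yes (a Fin.≟ a) refl

δ-≢ : {a x : Fin n} → a ≢ x → δ a x ≡ 0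
δ-≢ {a = a} {x} = 𝟙-no (a Fin.≟ x)

sum-δ* : (a : Fin n) (g : Fin n → ℕ) → sum (λ x → δ a x * g x) ≡ g a
sum-δ* {suc n} zero    g = begin
  1 * g zero + sum {n} (λ _ → 0) ≡⟨ cong₂ _+_ (*-identityˡ _) (sum-replicate-zero n) ⟩
  g zero + 0                     ≡⟨ +-identityʳ _ ⟩
  g zero                         ∎
  where open ≡-Reasoning
sum-δ* {suc n} (suc a) g = sum-δ* a (g ∘ suc)

sum-δ : (a : Fin n) → sum (δ a) ≡ 1
sum-δ a = trans (sum-cong-≗ (λ x → sym (*-identityʳ (δ a x)))) (sum-δ* a (λ _ → 1))

maximum : (Fin n → ℕ) → ℕ
maximum {zero}  f = 0
maximum {suc n} f = f zero ⊔ maximum (f ∘ suc)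

≤maximum : (f : Fin n → ℕ) (i : Fin n) → f i ≤ maximum f
≤maximum f zero    = m≤m⊔n _ _
≤maximum f (suc i) = ≤-trans (≤maximum (f ∘ suc) i) (m≤n⊔m _ _)

maximum-lub : (f : Fin n → ℕ) {b : ℕ} → (∀ i → f i ≤ b) → maximum f ≤ b
maximum-lub {zero}  f h = z≤n
maximum-lub {suc n} f h = ⊔-lub (h zero) (maximum-lub (f ∘ suc) (h ∘ suc))

maximum-positive : (f : Fin n → ℕ) → 1 ≤ maximum f → ∃[ i ] 1 ≤ f i
maximum-positive {suc n} f h with f zero in eq
... | suc _ = zero , subst (1 ≤_) (sym eq) (s≤s z≤n)
... | zero  with maximum-positive (f ∘ suc) h
...   | i , 1≤fi = suc i , 1≤fi

-- Levels of vertices and insertion of an edge into a metric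

-- The largest exponent from 1 to `j` whose power of `D` is at most `δ`. The value 0 is the default
-- and says nothing about `δ`, hence the positivity hypothesis of `level-lower`.
level : (D j δ : ℕ) → ℕ
level D zero    δ = 0
level D (suc j) δ with D ^ suc j ≤? δ
... | yes _ = suc j
... | no  _ = level D j δ

level≤ : ∀ D j δ → level D j δ ≤ j
level≤ D zero    δ = z≤n
level≤ D (suc j) δ with D ^ suc j ≤? δ
... | yes _ = ≤-refl
... | no  _ = m≤n⇒m≤1+n (level≤ D j δ)

level-mono : ∀ D j {δ ε} → δ ≤ ε → level D j δ ≤ level D j ε
level-mono D zero    δ≤ε = z≤n
level-mono D (suc j) {δ} {ε} δ≤ε with D ^ suc j ≤? δ | D ^ suc j ≤? ε
... | yes p | yes _ = ≤-refl
... | yes p | no ¬q = ⊥-elim (¬q (≤-trans p δ≤ε))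
... | no  _ | yes _ = m≤n⇒m≤1+n (≤-trans (level-mono D j δ≤ε) (level≤ D j ε))
... | no  _ | no  _ = level-mono D j δ≤ε

level-lower : ∀ D j δ → 1 ≤ level D j δ → D ^ level D j δ ≤ δ
level-lower D (suc j) δ h with D ^ suc j ≤? δ
... | yes p = p
... | no  _ = level-lower D j δ h

level-upper : ∀ D j δ w → w ≤ j → 1 ≤ w → D ^ w ≤ δ → w ≤ level D j δ
level-upper D zero    δ w w≤j 1≤w p = w≤j
level-upper D (suc j) δ w w≤j 1≤w p with D ^ suc j ≤? δ
... | yes _ = w≤j
... | no ¬q with m≤n⇒m<n∨m≡n w≤j
...   | inj₁ (s≤s w≤j′) = level-upper D j δ w w≤j′ 1≤w p
...   | inj₂ refl       = ⊥-elim (¬q p)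

Matrix : ℕ → Set
Matrix n = Fin n → Fin n → ℕ

record IsPseudometric {n : ℕ} (d : Matrix n) : Set where
  field
    d-refl : ∀ x → d x x ≡ 0
    d-sym  : ∀ x y → d x y ≡ d y x
    d-tri  : ∀ x y z → d x z ≤ d x y + d y z

-- The adjacency matrix of the single edge {a, b} when `a` and `b` differ. A query is thus recorded
-- in both orders and adds 2 to the total of a count matrix.
join : ∀ {n} (a b : Fin n) → Matrix n
join a b x y = δ a x * δ b y + δ b x * δ a y

module _ {n : ℕ} (a b : Fin n) where

  join-sym : ∀ x y → join a b x y ≡ join a b y x
  join-sym x y = lemma (δ a x) (δ b y) (δ b x) (δ a y)
    where
    lemma : ∀ p q r s → p * q + r * s ≡ s * r + q * p
    lemma = solve-∀

  join-ab : 1 ≤ join a b a b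
  join-ab rewrite δ-refl a | δ-refl b = s≤s z≤n

  join-ba : 1 ≤ join a b b a
  join-ba = subst (1 ≤_) (join-sym a b) join-ab

  join-row : ∀ x → sum (join a b x) ≡ δ a x + δ b x
  join-row x = begin
    sum (join a b x)
      ≡⟨ ∑-distrib-+ (λ y → δ a x * δ b y) (λ y → δ b x * δ a y) ⟩
    sum (λ y → δ a x * δ b y) + sum (λ y → δ b x * δ a y)
      ≡⟨ cong₂ _+_ (row a b) (row b a) ⟩
    δ a x + δ b x ∎
    where
    open ≡-Reasoning
    row : ∀ c e → sum (λ y → δ c x * δ e y) ≡ δ c x
    row c e = trans (sym (*-distribˡ-sum (δ c x) (δ e)))
                    (trans (cong (δ c x *_) (sum-δ e)) (*-identityʳ _))

  join-total : sum (λ x → sum (join a b x)) ≡ 2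
  join-total = begin
    sum (λ x → sum (join a b x))  ≡⟨ sum-cong-≗ join-row ⟩
    sum (λ x → δ a x + δ b x)     ≡⟨ ∑-distrib-+ (δ a) (δ b) ⟩
    sum (δ a) + sum (δ b)         ≡⟨ cong₂ _+_ (sum-δ a) (sum-δ b) ⟩
    2                             ∎
    where open ≡-Reasoning

  join-support : ∀ x y → 1 ≤ join a b x y → (x ≡ a × y ≡ b) ⊎ (x ≡ b × y ≡ a)
  join-support x y h with a Fin.≟ x | b Fin.≟ y | b Fin.≟ x | a Fin.≟ y
  ... | yes refl | yes refl | _        | _        = inj₁ (refl , refl)
  ... | _        | _        | yes refl | yes refl = inj₂ (refl , refl)
  ... | yes _    | no _     | yes _    | no _     with () ← h
  ... | yes _    | no _     | no _     | _        with () ← h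
  ... | no _     | _        | yes _    | no _     with () ← h
  ... | no _     | _        | no _     | _        with () ← h

_⊞_ : ∀ {n} → Matrix n → Matrix n → Matrix n
(A ⊞ B) x y = A x y + B x y

⊞-total : ∀ {n} (A B : Matrix n) →
          sum (λ x → sum ((A ⊞ B) x)) ≡ sum (λ x → sum (A x)) + sum (λ x → sum (B x))
⊞-total A B = trans (sum-cong-≗ (λ x → ∑-distrib-+ (A x) (B x)))
                    (∑-distrib-+ (λ x → sum (A x)) (λ x → sum (B x)))

detour : ∀ {n} → Matrix n → Fin n → Fin n → ℕ → Matrix n
detour d a b W x y = d x a + W + d b y

-- The shortest-path metric after an edge {a, b} of weight `W` is added to `d`: a shortest path
-- crosses the new edge at most once, in one of two directions.
shortcut : ∀ {n} → Matrix n → Fin n → Fin n → ℕ → Matrix n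
shortcut d a b W x y = d x y ⊓ (detour d a b W x y ⊓ detour d b a W x y)

module Shortcut {n : ℕ} (d : Matrix n) (isPseudo : IsPseudometric d) (a b : Fin n) (W : ℕ) where
  open IsPseudometric isPseudo

  d′ : Matrix n
  d′ = shortcut d a b W

  shortcut≤d : ∀ x y → d′ x y ≤ d x y
  shortcut≤d x y = m⊓n≤m _ _

  shortcut≤ab : ∀ x y → d′ x y ≤ detour d a b W x y
  shortcut≤ab x y = ≤-trans (m⊓n≤n (d x y) _) (m⊓n≤m _ _)

  shortcut≤ba : ∀ x y → d′ x y ≤ detour d b a W x y
  shortcut≤ba x y = ≤-trans (m⊓n≤n (d x y) _) (m⊓n≤n (detour d a b W x y) _)

  shortcut-cases : ∀ x y → d′ x y ≡ d x y ⊎ (d′ x y ≡ detour d a b W x y ⊎ d′ x y ≡ detour d b a W x y)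
  shortcut-cases x y with ⊓-sel (d x y) (detour d a b W x y ⊓ detour d b a W x y)
  ... | inj₁ eq = inj₁ eq
  ... | inj₂ eq with ⊓-sel (detour d a b W x y) (detour d b a W x y)
  ...   | inj₁ eq′ = inj₂ (inj₁ (trans eq eq′))
  ...   | inj₂ eq′ = inj₂ (inj₂ (trans eq eq′))

  shortcut-elim : ∀ (P : ℕ → Set) x y → P (d x y) → P (detour d a b W x y) →
                  P (detour d b a W x y) → P (d′ x y)
  shortcut-elim P x y p q r with shortcut-cases x y
  ... | inj₁ eq        = subst P (sym eq) p
  ... | inj₂ (inj₁ eq) = subst P (sym eq) q
  ... | inj₂ (inj₂ eq) = subst P (sym eq) r

  private
    detour-sym : ∀ a b x y → detour d a b W x y ≡ detour d b a W y x
    detour-sym a b x y = begin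
      d x a + W + d b y  ≡⟨ cong₂ (λ s t → s + W + t) (d-sym x a) (d-sym b y) ⟩
      d a x + W + d y b  ≡⟨ lemma (d a x) W (d y b) ⟩
      d y b + W + d a x  ∎
      where
      open ≡-Reasoning
      lemma : ∀ p q r → p + q + r ≡ r + q + p
      lemma = solve-∀

    d+detour : ∀ a b x y z → detour d a b W x z ≤ d x y + detour d a b W y z
    d+detour a b x y z = begin
      d x a + W + d b z            ≤⟨ +-monoˡ-≤ (d b z) (+-monoˡ-≤ W (d-tri x y a)) ⟩
      d x y + d y a + W + d b z    ≡⟨ lemma (d x y) (d y a) W (d b z) ⟩
      d x y + (d y a + W + d b z)  ∎
      where
      open ≤-Reasoning
      lemma : ∀ p q r s → p + q + r + s ≡ p + (q + r + s)
      lemma = solve-∀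

    detour+d : ∀ a b x y z → detour d a b W x z ≤ detour d a b W x y + d y z
    detour+d a b x y z = begin
      d x a + W + d b z            ≤⟨ +-monoʳ-≤ (d x a + W) (d-tri b y z) ⟩
      d x a + W + (d b y + d y z)  ≡⟨ sym (+-assoc (d x a + W) _ _) ⟩
      d x a + W + d b y + d y z    ∎
      where open ≤-Reasoning

    -- Two crossings in the same direction: everything between the start of the first and the end of
    -- one crossing can be cut out, leaving a single crossing.
    same-way : ∀ a b x y z → detour d a b W x z ≤ detour d a b W x y + detour d a b W y z
    same-way a b x y z = +-mono-≤ (m≤m+n (d x a + W) (d b y)) (m≤n+m (d b z) (d y a + W))

    -- A crossing followed by the reverse crossing: both can be cut out at `a`, leaving a path that
    -- avoids the new edge.
    there-and-back : ∀ a b x y z → d x z ≤ detour d a b W x y + detour d b a W y z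
    there-and-back a b x y z = begin
      d x z                                      ≤⟨ d-tri x a z ⟩
      d x a + d a z                              ≤⟨ +-mono-≤ (≤-trans (m≤m+n (d x a) W) (m≤m+n (d x a + W) (d b y))) (m≤n+m (d a z) (d y b + W)) ⟩
      detour d a b W x y + detour d b a W y z    ∎
      where open ≤-Reasoning

  shortcut-pseudo : IsPseudometric d′
  shortcut-pseudo = record
    { d-refl = λ x → n≤0⇒n≡0 (≤-trans (shortcut≤d x x) (≤-reflexive (d-refl x)))
    ; d-sym  = λ x y → cong₂ _⊓_ (d-sym x y)
                 (trans (cong₂ _⊓_ (detour-sym a b x y) (detour-sym b a x y))
                        (⊓-comm (detour d b a W y x) (detour d a b W y x)))
    ; d-tri  = triangle
    }
    where
    triangle : ∀ x y z → d′ x z ≤ d′ x y + d′ y z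
    triangle x y z = shortcut-elim (λ t → d′ x z ≤ t + d′ y z) x y
      (shortcut-elim (λ t → d′ x z ≤ d x y + t) y z
        (≤-trans (shortcut≤d x z) (d-tri x y z))
        (≤-trans (shortcut≤ab x z) (d+detour a b x y z))
        (≤-trans (shortcut≤ba x z) (d+detour b a x y z)))
      (shortcut-elim (λ t → d′ x z ≤ detour d a b W x y + t) y z
        (≤-trans (shortcut≤ab x z) (detour+d a b x y z))
        (≤-trans (shortcut≤ab x z) (same-way a b x y z))
        (≤-trans (shortcut≤d x z) (there-and-back a b x y z)))
      (shortcut-elim (λ t → d′ x z ≤ detour d b a W x y + t) y z
        (≤-trans (shortcut≤ba x z) (detour+d b a x y z))
        (≤-trans (shortcut≤d x z) (there-and-back b a x y z))
        (≤-trans (shortcut≤ba x z) (same-way b a x y z)))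

  shortcut-ab : W ≤ d a b → d′ a b ≡ W
  shortcut-ab W≤d = ≤-antisym
    (≤-trans (shortcut≤ab a b) (≤-reflexive (begin
      d a a + W + d b b  ≡⟨ cong₂ (λ s t → s + W + t) (d-refl a) (d-refl b) ⟩
      W + 0              ≡⟨ +-identityʳ W ⟩
      W                  ∎)))
    (shortcut-elim (W ≤_) a b W≤d
      (≤-trans (m≤n+m W (d a a)) (m≤m+n _ (d b b)))
      (≤-trans (m≤n+m W (d a b)) (m≤m+n _ (d a b))))
    where open ≡-Reasoning

-- The answering strategy

module Game (n k′ D : ℕ) where

  k : ℕ
  k = suc k′

  lev : Matrix n → Fin n → ℕ
  lev E u = level D k′ (sum (E u))

  pot : Matrix n → Matrix n → Fin n → ℕ
  pot d E x = maximum (λ u → lev E u ∸ d u x)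

  pot-lipschitz : ∀ {d} E → IsPseudometric d → ∀ x y → pot d E x ≤ d x y + pot d E y
  pot-lipschitz {d} E isPseudo x y = maximum-lub _ λ u → m≤n+o⇒m∸n≤o _ (d u x) (begin
    lev E u                                  ≤⟨ m≤n+m∸n (lev E u) (d u y) ⟩
    d u y + (lev E u ∸ d u y)                ≤⟨ +-mono-≤ (d-tri u x y) (≤maximum _ u) ⟩
    d u x + d x y + pot d E y                ≡⟨ +-assoc (d u x) _ _ ⟩
    d u x + (d x y + pot d E y)              ∎)
    where
    open ≤-Reasoning
    open IsPseudometric isPseudo

  lev≤pot : ∀ {d} E → IsPseudometric d → ∀ x → lev E x ≤ pot d E x
  lev≤pot E isPseudo x =
    ≤-trans (≤-reflexive (cong (lev E x ∸_) (sym (IsPseudometric.d-refl isPseudo x)))) (≤maximum _ x)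

  -- In the course of the game distances only shrink and query counts only grow, so potentials only
  -- grow. This lets the bound `E-tight` survive later queries.
  pot-mono : ∀ {d d′ E E′} → (∀ x y → d′ x y ≤ d x y) → (∀ x y → E x y ≤ E′ x y) →
             ∀ x → pot d E x ≤ pot d′ E′ x
  pot-mono d′≤d E≤E′ x = maximum-lub _ λ u →
    ≤-trans (∸-mono (level-mono D k′ (sum-mono (E≤E′ u))) (d′≤d u x)) (≤maximum _ u)

  pot≤ : ∀ d E x → pot d E x ≤ k′
  pot≤ d E x = maximum-lub _ λ u → ≤-trans (m∸n≤m _ (d u x)) (level≤ D k′ _)

  -- E counts the queries of each pair; e w counts those that inserted an edge of weight w into d,
  -- leaving out the queries whose answer d already forced.
  record State : Set where
    field
      d        : Matrix n
      E        : Matrix n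
      e        : ℕ → Matrix n
      isPseudo : IsPseudometric d
      d-pos    : ∀ x y → x ≢ y → 1 ≤ d x y
      d-cap    : ∀ x y → d x y ≤ suc k
      E-sym    : ∀ x y → E x y ≡ E y x
      e≤E      : ∀ w x y → e w x y ≤ E x y
      e-cap    : ∀ w x → w ≤ k′ → sum (e w x) ≤ D ^ w
      -- `d` is the shortest-path metric of the inserted edges, truncated at `k + 1`. Only this
      -- trace of it is kept: a pair at distance at most `k` is joined through a last inserted edge
      -- {z, y} of weight `w`.
      lastEdge : ∀ x y → x ≢ y → d x y ≤ k →
                 ∃₂ λ z w → 1 ≤ w × 1 ≤ e w z y × d x z + w ≤ d x y
      -- The bound that freezes answers: every later detour between `x` and `y` is at least the
      -- right-hand side, so it cannot shorten a queried pair.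
      E-tight  : ∀ x y → 1 ≤ E x y → d x y ≤ suc (pot d E x ⊔ pot d E y)
    open IsPseudometric isPseudo public

  record _⟶_ (s t : State) : Set where
    field
      keeps-E : ∀ x y → State.E s x y ≤ State.E t x y
      keeps-d : ∀ x y → 1 ≤ State.E s x y → State.d t x y ≡ State.d s x y

  ⟶-refl : ∀ {s} → s ⟶ s
  ⟶-refl = record { keeps-E = λ _ _ → ≤-refl ; keeps-d = λ _ _ _ → refl }

  ⟶-trans : ∀ {s t u} → s ⟶ t → t ⟶ u → s ⟶ u
  ⟶-trans p q = record
    { keeps-E = λ x y → ≤-trans (keeps-E p x y) (keeps-E q x y)
    ; keeps-d = λ x y h → trans (keeps-d q x y (≤-trans h (keeps-E p x y))) (keeps-d p x y h)
    }
    where open _⟶_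

  total : State → ℕ
  total s = sum (λ x → sum (State.E s x))

  initial : State
  initial = record
    { d = λ x y → (1 ∸ δ x y) * suc k
    ; E = λ _ _ → 0
    ; e = λ _ _ _ → 0
    ; isPseudo = record
      { d-refl = λ x → cong (λ t → (1 ∸ t) * suc k) (δ-refl x)
      ; d-sym  = λ x y → cong (λ t → (1 ∸ t) * suc k) (δ-sym x y)
      ; d-tri  = tri
      }
    ; d-pos = λ x y x≢y → subst (1 ≤_) (sym (off x≢y)) (s≤s z≤n)
    ; d-cap = cap
    ; E-sym = λ _ _ → refl
    ; e≤E = λ _ _ _ → z≤n
    ; e-cap = λ w x _ → ≤-trans (≤-reflexive (sum-replicate-zero n)) z≤n
    ; lastEdge = λ x y x≢y h → ⊥-elim (1+n≰n (subst (_≤ k) (off x≢y) h))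
    ; E-tight = λ _ _ ()
    }
    where
    δ-sym : ∀ (x y : Fin n) → δ x y ≡ δ y x
    δ-sym x y with x Fin.≟ y
    ... | yes refl = sym (δ-refl x)
    ... | no  x≢y  = sym (δ-≢ (x≢y ∘ sym))
    off : ∀ {x y} → x ≢ y → (1 ∸ δ x y) * suc k ≡ suc k
    off x≢y = trans (cong (λ t → (1 ∸ t) * suc k) (δ-≢ x≢y)) (*-identityˡ (suc k))
    cap : ∀ x y → (1 ∸ δ x y) * suc k ≤ suc k
    cap x y = ≤-trans (*-monoˡ-≤ (suc k) (m∸n≤m 1 (δ x y))) (≤-reflexive (*-identityˡ (suc k)))
    tri : ∀ x y z → (1 ∸ δ x z) * suc k ≤ (1 ∸ δ x y) * suc k + (1 ∸ δ y z) * suc k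
    tri x y z with x Fin.≟ y
    ... | yes refl = ≤-refl
    ... | no  x≢y  = ≤-trans (cap x z) (≤-trans (≤-reflexive (sym (*-identityˡ (suc k)))) (m≤m+n _ _))

  module Step (s : State) (a b : Fin n) (a≢b : a ≢ b) where
    open State s

    F : ℕ
    F = suc (pot d E a ⊔ pot d E b)

    F≤k : F ≤ k
    F≤k = s≤s (⊔-lub (pot≤ d E a) (pot≤ d E b))

    E′ : Matrix n
    E′ = E ⊞ join a b

    E≤E′ : ∀ x y → E x y ≤ E′ x y
    E≤E′ x y = m≤m+n _ _

    E′-sym : ∀ x y → E′ x y ≡ E′ y x
    E′-sym x y = cong₂ _+_ (E-sym x y) (join-sym a b x y)

    -- Pairs queried earlier keep their bound because distances drop and potentials grow; the new
    -- pair is bounded by `F`, computed from the old potentials. With d′ = d this also serves the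
    -- forced case.
    E′-tight : ∀ d′ → (∀ x y → d′ x y ≤ d x y) → d′ a b ≤ F → d′ b a ≤ F →
               ∀ x y → 1 ≤ E′ x y → d′ x y ≤ suc (pot d′ E′ x ⊔ pot d′ E′ y)
    E′-tight d′ d′≤d ab ba x y h = ≤-trans (old x y h) (s≤s (⊔-mono-≤ (mono x) (mono y)))
      where
      mono : ∀ x → pot d E x ≤ pot d′ E′ x
      mono = pot-mono d′≤d E≤E′
      old : ∀ x y → 1 ≤ E′ x y → d′ x y ≤ suc (pot d E x ⊔ pot d E y)
      old x y h with E x y in eq
      ... | suc _ = ≤-trans (d′≤d x y) (E-tight x y (subst (1 ≤_) (sym eq) (s≤s z≤n)))
      ... | zero with join-support a b x y h
      ...   | inj₁ (refl , refl) = ab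
      ...   | inj₂ (refl , refl) = ≤-trans ba (≤-reflexive (cong suc (⊔-comm (pot d E a) (pot d E b))))

    record Outcome : Set where
      field
        next   : State
        W      : ℕ
        W-low  : 1 ≤ W
        W-high : W ≤ k
        evolve : s ⟶ next
        asked  : 1 ≤ State.E next a b
        answer : State.d next a b ≡ W
        count  : total next ≡ total s + 2

    asked′ : 1 ≤ E′ a b
    asked′ = ≤-trans (join-ab a b) (m≤n+m _ (E a b))

    count′ : sum (λ x → sum (E′ x)) ≡ total s + 2
    count′ = trans (⊞-total E (join a b)) (cong (total s +_) (join-total a b))

    forced : d a b ≤ F → Outcome
    forced d≤F = record
      { next = record
        { d = d ; E = E′ ; e = e
        ; isPseudo = isPseudo ; d-pos = d-pos ; d-cap = d-cap
        ; E-sym = E′-sym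
        ; e≤E = λ w x y → ≤-trans (e≤E w x y) (E≤E′ x y)
        ; e-cap = e-cap ; lastEdge = lastEdge
        ; E-tight = E′-tight d (λ _ _ → ≤-refl) d≤F (subst (_≤ F) (d-sym a b) d≤F)
        }
      ; W = d a b
      ; W-low = d-pos a b a≢b
      ; W-high = ≤-trans d≤F F≤k
      ; evolve = record { keeps-E = E≤E′ ; keeps-d = λ _ _ _ → refl }
      ; asked = asked′
      ; answer = refl
      ; count = count′
      }

    module Free (F<d : F < d a b) where
      open Shortcut d isPseudo a b F
      open IsPseudometric shortcut-pseudo using () renaming (d-sym to d′-sym)

      -- A detour through the new edge is at least the potential of either end, because F dominates
      -- the potential of a and of b and the potential is 1-Lipschitz.
      detour-large : ∀ a b → pot d E a < F → pot d E b < F → ∀ x y →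
                     suc (pot d E x ⊔ pot d E y) ≤ detour d a b F x y
      detour-large a b a<F b<F x y = ⊔-lub
        (begin
          suc (pot d E x)           ≤⟨ s≤s (pot-lipschitz E isPseudo x a) ⟩
          suc (d x a + pot d E a)   ≡⟨ sym (+-suc (d x a) _) ⟩
          d x a + suc (pot d E a)   ≤⟨ +-monoʳ-≤ (d x a) a<F ⟩
          d x a + F                 ≤⟨ m≤m+n _ (d b y) ⟩
          d x a + F + d b y         ∎)
        (begin
          suc (pot d E y)           ≤⟨ s≤s (pot-lipschitz E isPseudo y b) ⟩
          suc (d y b + pot d E b)   ≡⟨ sym (+-suc (d y b) _) ⟩
          d y b + suc (pot d E b)   ≤⟨ +-monoʳ-≤ (d y b) b<F ⟩
          d y b + F                 ≡⟨ +-comm (d y b) F ⟩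
          F + d y b                 ≡⟨ cong (F +_) (d-sym y b) ⟩
          F + d b y                 ≤⟨ +-monoˡ-≤ (d b y) (m≤n+m F (d x a)) ⟩
          d x a + F + d b y         ∎)
        where open ≤-Reasoning

      a<F : pot d E a < F
      a<F = s≤s (m≤m⊔n _ _)

      b<F : pot d E b < F
      b<F = s≤s (m≤n⊔m (pot d E a) _)

      -- For a queried pair, `E-tight` bounds the old distance by the quantity that `detour-large`
      -- puts below both detours, so the minimum is the old distance.
      keeps : ∀ x y → 1 ≤ E x y → d′ x y ≡ d x y
      keeps x y h = ≤-antisym (shortcut≤d x y) (shortcut-elim (d x y ≤_) x y ≤-refl
        (≤-trans (E-tight x y h) (detour-large a b a<F b<F x y))
        (≤-trans (E-tight x y h) (detour-large b a b<F a<F x y)))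

      e′ : ℕ → Matrix n
      e′ w x y = e w x y + 𝟙 (w ≟ F) * join a b x y

      e≤e′ : ∀ w x y → e w x y ≤ e′ w x y
      e≤e′ w x y = m≤m+n _ _

      new-e′ : ∀ x y → 1 ≤ join a b x y → 1 ≤ e′ F x y
      new-e′ x y h = ≤-trans h (≤-trans (≤-reflexive (begin
        join a b x y                    ≡⟨ sym (*-identityˡ _) ⟩
        1 * join a b x y                ≡⟨ cong (_* join a b x y) (sym (𝟙-yes (F ≟ F) refl)) ⟩
        𝟙 (F ≟ F) * join a b x y        ∎)) (m≤n+m _ (e F x y)))
        where open ≡-Reasoning

      e′≤E′ : ∀ w x y → e′ w x y ≤ E′ x y
      e′≤E′ w x y = +-mono-≤ (e≤E w x y)
        (≤-trans (*-monoˡ-≤ (join a b x y) (𝟙≤1 (w ≟ F))) (≤-reflexive (*-identityˡ _)))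

      -- An endpoint of an edge of weight F ≤ k′ has level below F, hence fewer than D ^ F queries so far.
      room : ∀ x → pot d E x < F → F ≤ k′ → sum (e F x) < D ^ F
      room x x<F F≤k′ = ≤-<-trans (sum-mono (e≤E F x)) (≰⇒> λ h →
        <-irrefl refl (≤-<-trans (level-upper D k′ _ F F≤k′ (s≤s z≤n) h)
                                 (≤-<-trans (lev≤pot E isPseudo x) x<F)))

      e′-row : ∀ w x → sum (e′ w x) ≡ sum (e w x) + 𝟙 (w ≟ F) * (δ a x + δ b x)
      e′-row w x = trans (∑-distrib-+ (e w x) _) (cong (sum (e w x) +_)
        (trans (sym (*-distribˡ-sum (𝟙 (w ≟ F)) (join a b x))) (cong (𝟙 (w ≟ F) *_) (join-row a b x))))

      -- Only the rows of `a` and `b` in the class of weight `F` grow, each by one since `a` and `b`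
      -- differ; `room` supplies the free place.
      e′-cap : ∀ w x → w ≤ k′ → sum (e′ w x) ≤ D ^ w
      e′-cap w x w≤k′ = ≤-trans (≤-reflexive (e′-row w x)) (bound (w ≟ F))
        where
        plus-one : w ≡ F → pot d E x < F → sum (e w x) + 1 ≤ D ^ w
        plus-one refl x<F = ≤-trans (≤-reflexive (+-comm _ 1)) (room x x<F w≤k′)
        bound : (p : Dec (w ≡ F)) → sum (e w x) + 𝟙 p * (δ a x + δ b x) ≤ D ^ w
        bound (no _)  = ≤-trans (≤-reflexive (+-identityʳ _)) (e-cap w x w≤k′)
        bound (yes w≡F) with a Fin.≟ x | b Fin.≟ x
        ... | yes refl | yes refl = ⊥-elim (a≢b refl)
        ... | yes refl | no _     = plus-one w≡F a<F
        ... | no _     | yes refl = plus-one w≡F b<F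
        ... | no _     | no _     = ≤-trans (≤-reflexive (+-identityʳ _)) (e-cap w x w≤k′)

      LastEdge : Fin n → Fin n → ℕ → Set
      LastEdge x y r = ∃₂ λ z w → 1 ≤ w × 1 ≤ e′ w z y × d′ x z + w ≤ r

      -- If the detour stops right after the new edge, that edge is the last one. Otherwise the last
      -- edge of the remaining stretch from `b` to `y` is, and removing it leaves a detour to `z`.
      via-detour : ∀ a b → 1 ≤ e′ F a b → (∀ x y → d′ x y ≤ detour d a b F x y) →
                   ∀ x y → detour d a b F x y ≤ k → LastEdge x y (detour d a b F x y)
      via-detour a b new d′≤ x y h with b Fin.≟ y
      ... | yes refl = a , F , s≤s z≤n , new ,
                       ≤-trans (+-monoˡ-≤ F (shortcut≤d x a)) (m≤m+n _ (d b b))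
      ... | no  b≢y with lastEdge b y b≢y (≤-trans (m≤n+m _ (d x a + F)) h)
      ...   | z , w , 1≤w , 1≤e , le = z , w , 1≤w , ≤-trans 1≤e (e≤e′ w z y) , (begin
        d′ x z + w                 ≤⟨ +-monoˡ-≤ w (d′≤ x z) ⟩
        d x a + F + d b z + w      ≡⟨ +-assoc (d x a + F) _ w ⟩
        d x a + F + (d b z + w)    ≤⟨ +-monoʳ-≤ (d x a + F) le ⟩
        d x a + F + d b y          ∎)
        where open ≤-Reasoning

      lastEdge′ : ∀ x y → x ≢ y → d′ x y ≤ k → LastEdge x y (d′ x y)
      lastEdge′ x y x≢y = shortcut-elim (λ t → t ≤ k → LastEdge x y t) x y
        (λ h → let z , w , 1≤w , 1≤e , le = lastEdge x y x≢y h in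
               z , w , 1≤w , ≤-trans 1≤e (e≤e′ w z y) , ≤-trans (+-monoˡ-≤ w (shortcut≤d x z)) le)
        (via-detour a b (new-e′ a b (join-ab a b)) shortcut≤ab x y)
        (via-detour b a (new-e′ b a (join-ba a b)) shortcut≤ba x y)

      answer′ : d′ a b ≡ F
      answer′ = shortcut-ab (<⇒≤ F<d)

      outcome : Outcome
      outcome = record
        { next = record
          { d = d′ ; E = E′ ; e = e′
          ; isPseudo = shortcut-pseudo
          ; d-pos = λ x y x≢y → shortcut-elim (1 ≤_) x y (d-pos x y x≢y)
                      (≤-trans (s≤s z≤n) (detour-large a b a<F b<F x y))
                      (≤-trans (s≤s z≤n) (detour-large b a b<F a<F x y))
          ; d-cap = λ x y → ≤-trans (shortcut≤d x y) (d-cap x y)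
          ; E-sym = E′-sym
          ; e≤E = e′≤E′
          ; e-cap = e′-cap
          ; lastEdge = lastEdge′
          ; E-tight = E′-tight d′ shortcut≤d (≤-reflexive answer′)
                        (≤-reflexive (trans (d′-sym b a) answer′))
          }
        ; W = F
        ; W-low = s≤s z≤n
        ; W-high = F≤k
        ; evolve = record { keeps-E = E≤E′ ; keeps-d = keeps }
        ; asked = asked′
        ; answer = answer′
        ; count = count′
        }

    step : Outcome
    step with d a b ≤? F
    ... | yes d≤F = forced d≤F
    ... | no  d≰F = Free.outcome (≰⇒> d≰F)

  -- Playing a whole query procedure

  record Play (m : ℕ) (Pair : Procedure n m) (s : State) : Set where
    field
      p          : Fin m → UPair n
      w          : Fin m → ℕ
      w-range    : ∀ i → 1 ≤ w i × w i ≤ k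
      consistent : ∀ i → p i ≡ Pair i (history p w i)
      final      : State
      evolve     : s ⟶ final
      asked      : ∀ i → 1 ≤ State.E final (proj₁ (proj₁ (p i))) (proj₂ (proj₁ (p i)))
      answered   : ∀ i → State.d final (proj₁ (proj₁ (p i))) (proj₂ (proj₁ (p i))) ≡ w i
      count      : total final ≡ total s + 2 * m

  play : ∀ m (Pair : Procedure n m) (s : State) → Play m Pair s
  play zero Pair s = record
    { p = λ () ; w = λ () ; w-range = λ () ; consistent = λ ()
    ; final = s ; evolve = ⟶-refl ; asked = λ () ; answered = λ () ; count = sym (+-identityʳ _) }
  play (suc m) Pair s = record
    { p          = λ { zero → q ; (suc i) → R.p i }
    ; w          = λ { zero → O.W ; (suc i) → R.w i }
    ; w-range    = λ { zero → O.W-low , O.W-high ; (suc i) → R.w-range i }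
    ; consistent = λ { zero → refl ; (suc i) → R.consistent i }
    ; final      = R.final
    ; evolve     = ⟶-trans O.evolve R.evolve
    ; asked      = λ { zero → ≤-trans O.asked (_⟶_.keeps-E R.evolve a b) ; (suc i) → R.asked i }
    ; answered   = λ { zero → trans (_⟶_.keeps-d R.evolve a b O.asked) O.answer ; (suc i) → R.answered i }
    ; count      = begin
        total R.final            ≡⟨ R.count ⟩
        total O.next + 2 * m     ≡⟨ cong (_+ 2 * m) O.count ⟩
        total s + 2 + 2 * m      ≡⟨ +-assoc (total s) 2 (2 * m) ⟩
        total s + (2 + 2 * m)    ≡⟨ cong (total s +_) (sym (*-suc 2 m)) ⟩
        total s + 2 * suc m      ∎
    }
    where
    open ≡-Reasoning
    q : UPair n
    q = Pair zero []
    a b : Fin n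
    a = proj₁ (proj₁ q)
    b = proj₂ (proj₁ q)
    module O = Step.Outcome (Step.step s a b (Finₚ.<⇒≢ (proj₂ q)))
    -- After the first query the rest is again a procedure: its histories get the first pair and
    -- answer prepended.
    module R = Play (play m (λ i h → Pair (suc i) ((q , toℚ O.W) ∷ h)) O.next)

-- Ball sizes

-- Dividing the sum by D^r leaves 2^(r-1) + ... + 1 = 2^r - 1, and the additional 1 is at most D^r.
-- It shows that (2D)^r solves the recursion for ball sizes.
geometric : ∀ D r → 1 ≤ D → suc (∑[ i < r ] (D ^ suc (toℕ i) * (2 * D) ^ (r ∸ suc (toℕ i)))) ≤ (2 * D) ^ r
geometric D zero    1≤D = ≤-refl
geometric D (suc r) 1≤D = begin
  suc (D ^ 1 * (2 * D) ^ r + ∑[ i < r ] (D * D ^ suc (toℕ i) * (2 * D) ^ (r ∸ suc (toℕ i))))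
    ≡⟨ cong (λ t → suc (D ^ 1 * (2 * D) ^ r + t)) (trans (sum-cong-≗ {n = r} λ i → *-assoc D (D ^ suc (toℕ i)) _)
         (sym (*-distribˡ-sum D (λ (i : Fin r) → D ^ suc (toℕ i) * (2 * D) ^ (r ∸ suc (toℕ i)))))) ⟩
  suc (D ^ 1 * (2 * D) ^ r + D * S)
    ≡⟨ cong (λ t → suc (t * (2 * D) ^ r + D * S)) (*-identityʳ D) ⟩
  suc (D * (2 * D) ^ r + D * S)
    ≡⟨ sym (+-suc _ _) ⟩
  D * (2 * D) ^ r + suc (D * S)
    ≤⟨ +-monoʳ-≤ (D * (2 * D) ^ r) (+-monoˡ-≤ (D * S) 1≤D) ⟩
  D * (2 * D) ^ r + (D + D * S)
    ≡⟨ cong (D * (2 * D) ^ r +_) (sym (*-suc D S)) ⟩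
  D * (2 * D) ^ r + D * suc S
    ≤⟨ +-monoʳ-≤ (D * (2 * D) ^ r) (*-monoʳ-≤ D (geometric D r 1≤D)) ⟩
  D * (2 * D) ^ r + D * (2 * D) ^ r
    ≡⟨ lemma D ((2 * D) ^ r) ⟩
  2 * D * (2 * D) ^ r ∎
  where
  open ≤-Reasoning
  S : ℕ
  S = ∑[ i < r ] (D ^ suc (toℕ i) * (2 * D) ^ (r ∸ suc (toℕ i)))
  lemma : ∀ x y → x * y + x * y ≡ 2 * x * y
  lemma = solve-∀

^-distrib-* : ∀ a b r → (a * b) ^ r ≡ a ^ r * b ^ r
^-distrib-* a b zero    = refl
^-distrib-* a b (suc r) = begin
  a * b * (a * b) ^ r      ≡⟨ cong (a * b *_) (^-distrib-* a b r) ⟩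
  a * b * (a ^ r * b ^ r)  ≡⟨ [m*n]*[o*p]≡[m*o]*[n*p] a b (a ^ r) (b ^ r) ⟩
  a ^ suc r * b ^ suc r    ∎
  where open ≡-Reasoning

module Counting (n k′ D : ℕ) (1≤D : 1 ≤ D) (s : Game.State n k′ D) where
  open Game n k′ D
  open State s

  f : Fin n → ℕ
  f = pot d E

  deg : Fin n → ℕ
  deg x = sum (E x)

  ball : Fin n → ℕ → ℕ
  ball x r = sum (λ y → 𝟙 (d x y ≤? r))

  -- Contribution to ball x r of the paths whose last edge has weight w.
  layer : Fin n → ℕ → ℕ → ℕ
  layer x r w = sum (λ z → 𝟙 (d x z ≤? r ∸ w) * sum (e w z))

  -- Each point of the ball other than the centre is charged to its last inserted edge. Weights are
  -- written `suc (toℕ i)` because they run from 1 to `r`.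
  ball≤layers : ∀ x r → r ≤ k → ball x r ≤ suc (∑[ i < r ] layer x r (suc (toℕ i)))
  ball≤layers x r r≤k = begin
    ball x r
      ≤⟨ sum-mono pointwise ⟩
    sum (λ y → δ x y + ∑[ i < r ] sum (λ z → T (suc (toℕ i)) z y))
      ≡⟨ ∑-distrib-+ (δ x) _ ⟩
    sum (δ x) + sum (λ y → ∑[ i < r ] sum (λ z → T (suc (toℕ i)) z y))
      ≡⟨ cong₂ _+_ (sum-δ x) (∑-comm (λ y (i : Fin r) → sum (λ z → T (suc (toℕ i)) z y))) ⟩
    suc (∑[ i < r ] sum (λ y → sum (λ z → T (suc (toℕ i)) z y)))
      ≡⟨ cong suc (sum-cong-≗ {n = r} λ i → collect (suc (toℕ i))) ⟩
    suc (∑[ i < r ] layer x r (suc (toℕ i))) ∎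
    where
    open ≤-Reasoning
    T : ℕ → Fin n → Fin n → ℕ
    T w z y = 𝟙 (d x z ≤? r ∸ w) * e w z y
    collect : ∀ w → sum (λ y → sum (λ z → T w z y)) ≡ layer x r w
    collect w = trans (∑-comm (λ y z → T w z y))
      (sum-cong-≗ λ z → sym (*-distribˡ-sum (𝟙 (d x z ≤? r ∸ w)) (e w z)))
    reached : ∀ y → x ≢ y → d x y ≤ r → 1 ≤ ∑[ i < r ] sum (λ z → T (suc (toℕ i)) z y)
    reached y x≢y dxy≤r with lastEdge x y x≢y (≤-trans dxy≤r r≤k)
    ... | z , suc w , _ , 1≤e , le = begin
      1                                              ≤⟨ 1≤e ⟩
      e (suc w) z y                                  ≡⟨ sym (*-identityˡ _) ⟩
      1 * e (suc w) z y                              ≡⟨ cong (_* e (suc w) z y) (sym (𝟙-yes (_ ≤? _) near)) ⟩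
      T (suc w) z y                                  ≤⟨ term≤sum (λ z → T (suc w) z y) z ⟩
      sum (λ z → T (suc w) z y)                      ≡⟨ cong (λ v → sum (λ z → T (suc v) z y)) (sym (Finₚ.toℕ-fromℕ< w<r)) ⟩
      sum (λ z → T (suc (toℕ (fromℕ< w<r))) z y)     ≤⟨ term≤sum (λ (i : Fin r) → sum (λ z → T (suc (toℕ i)) z y)) (fromℕ< w<r) ⟩
      ∑[ i < r ] sum (λ z → T (suc (toℕ i)) z y)     ∎
      where
      dxz+w≤r : d x z + suc w ≤ r
      dxz+w≤r = ≤-trans le dxy≤r
      w<r : w < r
      w<r = ≤-trans (m≤n+m (suc w) (d x z)) dxz+w≤r
      near : d x z ≤ r ∸ suc w
      near = m+n≤o⇒m≤o∸n (d x z) dxz+w≤r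
    pointwise : ∀ y → 𝟙 (d x y ≤? r) ≤ δ x y + ∑[ i < r ] sum (λ z → T (suc (toℕ i)) z y)
    pointwise y = 𝟙-bound (d x y ≤? r) λ dxy≤r → case dxy≤r (x Fin.≟ y)
      where
      case : d x y ≤ r → (p : Dec (x ≡ y)) → 1 ≤ 𝟙 p + ∑[ i < r ] sum (λ z → T (suc (toℕ i)) z y)
      case h (yes _)   = s≤s z≤n
      case h (no  x≢y) = reached y x≢y h

  layer≤ : ∀ x r w → w ≤ k′ → layer x r w ≤ D ^ w * ball x (r ∸ w)
  layer≤ x r w w≤k′ = begin
    layer x r w                                   ≤⟨ sum-mono (λ z → *-monoʳ-≤ (𝟙 (d x z ≤? r ∸ w)) (e-cap w z w≤k′)) ⟩
    sum (λ z → 𝟙 (d x z ≤? r ∸ w) * D ^ w)        ≡⟨ sym (*-distribʳ-sum (D ^ w) (λ z → 𝟙 (d x z ≤? r ∸ w))) ⟩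
    ball x (r ∸ w) * D ^ w                        ≡⟨ *-comm (ball x (r ∸ w)) (D ^ w) ⟩
    D ^ w * ball x (r ∸ w)                        ∎
    where open ≤-Reasoning

  BallBound : ℕ → Set
  BallBound r = ∀ x → r ≤ k′ → ball x r ≤ (2 * D) ^ r

  -- Strong induction on the radius: at most D^w edges of weight `w` leave each point of the ball of
  -- radius r - w. The radius stays below `k` because `e-cap` covers only weights up to `k′`.
  ball≤ : ∀ r → BallBound r
  ball≤ = <-rec BallBound λ r ih x r≤k′ → ≤-trans (ball≤layers x r (m≤n⇒m≤1+n r≤k′)) (≤-trans
    (s≤s (sum-mono {r} λ i → ≤-trans
      (layer≤ x r (suc (toℕ i)) (≤-trans (Finₚ.toℕ<n i) r≤k′))
      (*-monoʳ-≤ (D ^ suc (toℕ i))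
        (ih (∸-monoʳ-< (s≤s z≤n) (Finₚ.toℕ<n i)) x (≤-trans (m∸n≤m r (suc (toℕ i))) r≤k′)))))
    (geometric D r 1≤D))

  -- At radius `k` the edges of weight `k` enter, which have no cap. They can only start at distance
  -- 0, that is at `x` itself, so there are at most `deg x` of them. Allowing `deg x` in every layer
  -- gives the factor `k`.
  ball-k≤ : ∀ x → ball x k ≤ (2 * D) ^ k + k * deg x
  ball-k≤ x = begin
    ball x k
      ≤⟨ ball≤layers x k ≤-refl ⟩
    suc (∑[ i < k ] layer x k (suc (toℕ i)))
      ≤⟨ s≤s (sum-mono {k} term) ⟩
    suc (∑[ i < k ] (D ^ suc (toℕ i) * (2 * D) ^ (k ∸ suc (toℕ i)) + deg x))
      ≡⟨ cong suc (∑-distrib-+ {k} (λ i → D ^ suc (toℕ i) * (2 * D) ^ (k ∸ suc (toℕ i))) (λ _ → deg x)) ⟩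
    suc (∑[ i < k ] (D ^ suc (toℕ i) * (2 * D) ^ (k ∸ suc (toℕ i))) + sum {k} (λ _ → deg x))
      ≤⟨ +-mono-≤ (geometric D k 1≤D) (≤-reflexive (sum-const k (deg x))) ⟩
    (2 * D) ^ k + k * deg x ∎
    where
    open ≤-Reasoning
    top : layer x k k ≤ deg x
    top = ≤-trans (sum-mono only-x) (≤-reflexive (sum-δ* x deg))
      where
      only-x : ∀ z → 𝟙 (d x z ≤? k ∸ k) * sum (e k z) ≤ δ x z * deg z
      only-x z = *-mono-≤ (𝟙-bound (d x z ≤? k ∸ k) at-x) (sum-mono (e≤E k z))
        where
        at-x : d x z ≤ k ∸ k → 1 ≤ δ x z
        at-x h with x Fin.≟ z
        ... | yes _   = ≤-refl
        ... | no  x≢z = ⊥-elim (<⇒≱ (d-pos x z x≢z) (subst (d x z ≤_) (n∸n≡0 k) h))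
    term : ∀ i → layer x k (suc (toℕ i)) ≤ D ^ suc (toℕ i) * (2 * D) ^ (k ∸ suc (toℕ i)) + deg x
    term i with m≤n⇒m<n∨m≡n (Finₚ.toℕ<n i)
    ... | inj₁ (s≤s i≤k′) = ≤-trans
      (≤-trans (layer≤ x k (suc (toℕ i)) i≤k′)
               (*-monoʳ-≤ (D ^ suc (toℕ i)) (ball≤ (k ∸ suc (toℕ i)) x (m∸n≤m k′ (toℕ i)))))
      (m≤m+n _ (deg x))
    ... | inj₂ i≡k′ = ≤-trans (subst (λ w → layer x k w ≤ deg x) (sym i≡k′) top) (m≤n+m (deg x) _)

  close-pairs : sum (λ x → ball x k) ≤ n * (2 * D) ^ k + k * total s
  close-pairs = begin
    sum (λ x → ball x k)                                   ≤⟨ sum-mono ball-k≤ ⟩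
    sum (λ x → (2 * D) ^ k + k * deg x)                    ≡⟨ ∑-distrib-+ (λ _ → (2 * D) ^ k) (λ x → k * deg x) ⟩
    sum {n} (λ _ → (2 * D) ^ k) + sum (λ x → k * deg x)    ≡⟨ cong₂ _+_ (sum-const n _) (sym (*-distribˡ-sum k deg)) ⟩
    n * (2 * D) ^ k + k * total s                          ∎
    where open ≤-Reasoning

  -- Vertices of positive potential and points near a query

  high : ℕ
  high = sum (λ x → 𝟙 (1 ≤? f x))

  -- A vertex of positive potential lies within l - 1 of some `u` of level l ≥ 1. That ball has at
  -- most (2D)^(l-1) points, and D times this is at most 2^k′ D^l, where D^l is at most `deg u`.
  high≤ : D * high ≤ 2 ^ k′ * total s
  high≤ = begin
    D * high
      ≤⟨ *-monoʳ-≤ D (sum-mono pointwise) ⟩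
    D * sum (λ x → sum (λ u → 𝟙 (1 ≤? lev E u) * 𝟙 (d u x ≤? lev E u ∸ 1)))
      ≡⟨ cong (D *_) (trans (∑-comm (λ x u → 𝟙 (1 ≤? lev E u) * 𝟙 (d u x ≤? lev E u ∸ 1)))
           (sum-cong-≗ λ u → sym (*-distribˡ-sum (𝟙 (1 ≤? lev E u)) (λ x → 𝟙 (d u x ≤? lev E u ∸ 1))))) ⟩
    D * sum (λ u → 𝟙 (1 ≤? lev E u) * ball u (lev E u ∸ 1))
      ≡⟨ *-distribˡ-sum D (λ u → 𝟙 (1 ≤? lev E u) * ball u (lev E u ∸ 1)) ⟩
    sum (λ u → D * (𝟙 (1 ≤? lev E u) * ball u (lev E u ∸ 1)))
      ≤⟨ sum-mono charge ⟩
    sum (λ u → 2 ^ k′ * deg u)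
      ≡⟨ sym (*-distribˡ-sum (2 ^ k′) deg) ⟩
    2 ^ k′ * total s ∎
    where
    open ≤-Reasoning
    pointwise : ∀ x → 𝟙 (1 ≤? f x) ≤ sum (λ u → 𝟙 (1 ≤? lev E u) * 𝟙 (d u x ≤? lev E u ∸ 1))
    pointwise x = 𝟙-bound (1 ≤? f x) λ 1≤fx → witness (maximum-positive (λ u → lev E u ∸ d u x) 1≤fx)
      where
      witness : (∃[ u ] 1 ≤ lev E u ∸ d u x) → 1 ≤ sum (λ u → 𝟙 (1 ≤? lev E u) * 𝟙 (d u x ≤? lev E u ∸ 1))
      witness (u , h) = ≤-trans (≤-reflexive (sym (cong₂ _*_
          (𝟙-yes (1 ≤? lev E u) (≤-trans h (m∸n≤m _ (d u x))))
          (𝟙-yes (d u x ≤? lev E u ∸ 1) (m+n≤o⇒m≤o∸n (d u x) (subst (_≤ lev E u) (+-comm 1 _) (below h)))))))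
        (term≤sum (λ u → 𝟙 (1 ≤? lev E u) * 𝟙 (d u x ≤? lev E u ∸ 1)) u)
        where
        below : 1 ≤ lev E u ∸ d u x → suc (d u x) ≤ lev E u
        below h = ≰⇒> λ le → <⇒≱ h (≤-reflexive (m≤n⇒m∸n≡0 le))
    charge : ∀ u → D * (𝟙 (1 ≤? lev E u) * ball u (lev E u ∸ 1)) ≤ 2 ^ k′ * deg u
    charge u with lev E u | level≤ D k′ (deg u) | level-lower D k′ (deg u)
    ... | zero  | _    | _     = ≤-trans (≤-reflexive (*-zeroʳ D)) z≤n
    ... | suc l | l<k′ | lower = begin
      D * (1 * ball u l)    ≡⟨ cong (D *_) (*-identityˡ _) ⟩
      D * ball u l          ≤⟨ *-monoʳ-≤ D (ball≤ l u (≤-trans (n≤1+n l) l<k′)) ⟩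
      D * (2 * D) ^ l       ≡⟨ cong (D *_) (^-distrib-* 2 D l) ⟩
      D * (2 ^ l * D ^ l)   ≡⟨ lemma D (2 ^ l) (D ^ l) ⟩
      2 ^ l * (D * D ^ l)   ≤⟨ *-mono-≤ (^-monoʳ-≤ 2 (≤-trans (n≤1+n l) l<k′)) (lower (s≤s z≤n)) ⟩
      2 ^ k′ * deg u        ∎
      where
      lemma : ∀ p q r → p * (q * r) ≡ q * (p * r)
      lemma = solve-∀

  -- Queries {x, z} with `y` in the `k′`-ball of `z`, counted with multiplicity. It dominates the
  -- relation `Q` below and is easy to sum.
  near : Matrix n
  near x y = sum (λ z → E x z * 𝟙 (d z y ≤? k′))

  near-total : sum (λ x → sum (near x)) ≤ total s * (2 * D) ^ k′
  near-total = begin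
    sum (λ x → sum (near x))                        ≡⟨ sum-cong-≗ collect ⟩
    sum (λ x → sum (λ z → E x z * ball z k′))       ≤⟨ sum-mono (λ x → sum-mono (λ z → *-monoʳ-≤ (E x z) (ball≤ k′ z ≤-refl))) ⟩
    sum (λ x → sum (λ z → E x z * (2 * D) ^ k′))    ≡⟨ sum-cong-≗ (λ x → sym (*-distribʳ-sum ((2 * D) ^ k′) (E x))) ⟩
    sum (λ x → deg x * (2 * D) ^ k′)                ≡⟨ sym (*-distribʳ-sum ((2 * D) ^ k′) deg) ⟩
    total s * (2 * D) ^ k′                          ∎
    where
    open ≤-Reasoning
    collect : ∀ x → sum (near x) ≡ sum (λ z → E x z * ball z k′)
    collect x = trans (∑-comm (λ y z → E x z * 𝟙 (d z y ≤? k′)))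
      (sum-cong-≗ λ z → sym (*-distribˡ-sum (E x z) (λ y → 𝟙 (d z y ≤? k′))))

  -- The lower metric

  -- As `f` is 1-Lipschitz, the last inequality says that `f` falls at full rate from `z` to `y`.
  -- The choice z = y covers the queried pairs with the larger potential at `y`; the other `z` are
  -- the propagation of the raise.
  Q : Fin n → Fin n → Set
  Q x y = f x ≤ f y × ∃[ z ] (1 ≤ E x z × d z y + f y ≤ f z)

  Q? : ∀ x y → Dec (Q x y)
  Q? x y = (f x ≤? f y) ×-dec Finₚ.any? (λ z → (1 ≤? E x z) ×-dec (d z y + f y ≤? f z))

  P : Fin n → Fin n → Set
  P x y = Q x y ⊎ Q y x

  P? : ∀ x y → Dec (P x y)
  P? x y = Q? x y ⊎-dec Q? y x

  bump : Matrix n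
  bump x y = 𝟙 (P? x y)

  -- Twice the cap 1/2 + max (f x) (f y), with the raise of 1/2 on `P` appearing as `bump`.
  height : Matrix n
  height x y = suc (2 * (f x ⊔ f y)) + bump x y

  -- Twice the lower metric, to stay in ℕ.
  low : Matrix n
  low x y = 2 * d x y ⊓ height x y

  bump-sym : ∀ x y → bump x y ≡ bump y x
  bump-sym x y = ≤-antisym (𝟙-mono (P? x y) (P? y x) swap) (𝟙-mono (P? y x) (P? x y) swap)

  low-refl : ∀ x → low x x ≡ 0
  low-refl x = cong (λ t → 2 * t ⊓ height x x) (d-refl x)

  low-pos : ∀ x y → x ≢ y → 1 ≤ low x y
  low-pos x y x≢y = ⊓-glb (≤-trans (d-pos x y x≢y) (m≤n*m (d x y) 2)) (s≤s z≤n)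

  low-sym : ∀ x y → low x y ≡ low y x
  low-sym x y = cong₂ _⊓_ (cong (2 *_) (d-sym x y))
    (cong₂ (λ s t → suc (2 * s) + t) (⊔-comm (f x) (f y)) (bump-sym x y))

  low≤2d : ∀ x y → low x y ≤ 2 * d x y
  low≤2d x y = m⊓n≤m _ _

  low≤height : ∀ x y → low x y ≤ height x y
  low≤height x y = m⊓n≤n _ _

  f-lipschitz : ∀ x y → f x ≤ d x y + f y
  f-lipschitz = pot-lipschitz E isPseudo

  -- The only way the bump at (x , z) is not paid for by d y z is that f drops at full rate
  -- from z to y without going below f x; then (x , y) inherits the bump.
  P-inherit : ∀ x y z → f y < f z → f x ≤ f y → d y z + f y ≤ f z → P x z → P x y
  P-inherit x y z fy<fz fx≤fy drop (inj₂ (fz≤fx , _)) = ⊥-elim (<⇒≱ fy<fz (≤-trans fz≤fx fx≤fy))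
  P-inherit x y z fy<fz fx≤fy drop (inj₁ (_ , q , 1≤E , le)) = inj₁ (fx≤fy , q , 1≤E , (begin
    d q y + f y              ≤⟨ +-monoˡ-≤ (f y) (d-tri q z y) ⟩
    d q z + d z y + f y      ≡⟨ +-assoc (d q z) _ _ ⟩
    d q z + (d z y + f y)    ≡⟨ cong (λ t → d q z + (t + f y)) (d-sym z y) ⟩
    d q z + (d y z + f y)    ≤⟨ +-monoʳ-≤ (d q z) drop ⟩
    d q z + f z              ≤⟨ le ⟩
    f q                      ∎))
    where open ≤-Reasoning

  private
    2*-< : ∀ {p q} → p < q → suc (2 * p) + 1 ≤ 2 * q
    2*-< {p} {q} p<q = ≤-trans (≤-reflexive (lemma p)) (*-monoʳ-≤ 2 p<q)
      where
      lemma : ∀ p → suc (2 * p) + 1 ≡ 2 * suc p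
      lemma = solve-∀

  -- Compare max (f x) (f z) with max (f x) (f y) + d y z. If it is strictly smaller, doubling
  -- creates a gap of 2, which pays for any bump. If they are equal, `f` falls at full rate from `z`
  -- to `y`, and a bump at (x, z) passes to (x, y).
  height+2d : ∀ x y z → y ≢ z → height x z ≤ height x y + 2 * d y z
  height+2d x y z y≢z with m≤n⇒m<n∨m≡n M≤
    where
    M≤ : f x ⊔ f z ≤ (f x ⊔ f y) + d y z
    M≤ = ⊔-lub (≤-trans (m≤m⊔n (f x) (f y)) (m≤m+n _ _)) (begin
      f z                    ≤⟨ f-lipschitz z y ⟩
      d z y + f y            ≡⟨ +-comm (d z y) (f y) ⟩
      f y + d z y            ≤⟨ +-mono-≤ (m≤n⊔m (f x) (f y)) (≤-reflexive (d-sym z y)) ⟩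
      (f x ⊔ f y) + d y z    ∎)
      where open ≤-Reasoning
  ... | inj₁ lt = begin
    suc (2 * (f x ⊔ f z)) + bump x z             ≤⟨ +-monoʳ-≤ (suc (2 * (f x ⊔ f z))) (𝟙≤1 (P? x z)) ⟩
    suc (2 * (f x ⊔ f z)) + 1                    ≤⟨ 2*-< lt ⟩
    2 * ((f x ⊔ f y) + d y z)                    ≡⟨ *-distribˡ-+ 2 (f x ⊔ f y) (d y z) ⟩
    2 * (f x ⊔ f y) + 2 * d y z                  ≤⟨ +-monoˡ-≤ (2 * d y z) (≤-trans (n≤1+n (2 * (f x ⊔ f y))) (m≤m+n (suc (2 * (f x ⊔ f y))) (bump x y))) ⟩
    height x y + 2 * d y z                       ∎
    where open ≤-Reasoning
  ... | inj₂ eq = begin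
    suc (2 * (f x ⊔ f z)) + bump x z                     ≤⟨ +-monoʳ-≤ (suc (2 * (f x ⊔ f z))) (𝟙-mono (P? x z) (P? x y) inherit) ⟩
    suc (2 * (f x ⊔ f z)) + bump x y                     ≡⟨ cong (λ t → suc (2 * t) + bump x y) eq ⟩
    suc (2 * ((f x ⊔ f y) + d y z)) + bump x y           ≡⟨ lemma (f x ⊔ f y) (d y z) (bump x y) ⟩
    height x y + 2 * d y z                               ∎
    where
    open ≤-Reasoning
    lemma : ∀ p q r → suc (2 * (p + q)) + r ≡ suc (2 * p) + r + 2 * q
    lemma = solve-∀
    -- Since d y z > 0, equality forces the maximum at (x, z) to be `f z`; the Lipschitz bound then
    -- makes `f y` the maximum at (x, y).
    M<M : f x ⊔ f y < f x ⊔ f z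
    M<M = subst (f x ⊔ f y <_) (sym eq) (m<m+n (f x ⊔ f y) (d-pos y z y≢z))
    fz≡M : f x ⊔ f z ≡ f z
    fz≡M with ⊔-sel (f x) (f z)
    ... | inj₁ e≡x = ⊥-elim (<⇒≱ M<M (≤-trans (≤-reflexive e≡x) (m≤m⊔n (f x) (f y))))
    ... | inj₂ e≡z = e≡z
    M+d≤ : (f x ⊔ f y) + d y z ≤ f y + d y z
    M+d≤ = begin
      (f x ⊔ f y) + d y z  ≡⟨ sym eq ⟩
      f x ⊔ f z            ≡⟨ fz≡M ⟩
      f z                  ≤⟨ f-lipschitz z y ⟩
      d z y + f y          ≡⟨ +-comm (d z y) (f y) ⟩
      f y + d z y          ≡⟨ cong (f y +_) (d-sym z y) ⟩
      f y + d y z          ∎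
    M≤fy : f x ⊔ f y ≤ f y
    M≤fy = +-cancelʳ-≤ (d y z) _ _ M+d≤
    drop : d y z + f y ≤ f z
    drop = begin
      d y z + f y            ≡⟨ +-comm (d y z) (f y) ⟩
      f y + d y z            ≤⟨ +-monoˡ-≤ (d y z) (m≤n⊔m (f x) (f y)) ⟩
      (f x ⊔ f y) + d y z    ≡⟨ sym eq ⟩
      f x ⊔ f z              ≡⟨ fz≡M ⟩
      f z                    ∎
    inherit : P x z → P x y
    inherit = P-inherit x y z (≤-<-trans (m≤n⊔m (f x) (f y)) (subst (f x ⊔ f y <_) fz≡M M<M))
                              (≤-trans (m≤m⊔n (f x) (f y)) M≤fy) drop

  -- The constant 1 of the second height pays for the bump on the left.
  height+height : ∀ x y z → height x z ≤ height x y + height y z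
  height+height x y z = begin
    suc (2 * (f x ⊔ f z)) + bump x z                        ≤⟨ +-monoʳ-≤ (suc (2 * (f x ⊔ f z))) (𝟙≤1 (P? x z)) ⟩
    suc (2 * (f x ⊔ f z)) + 1                               ≤⟨ +-monoˡ-≤ 1 (s≤s (*-monoʳ-≤ 2 M≤)) ⟩
    suc (2 * ((f x ⊔ f y) + (f y ⊔ f z))) + 1               ≡⟨ lemma (f x ⊔ f y) (f y ⊔ f z) ⟩
    suc (2 * (f x ⊔ f y)) + suc (2 * (f y ⊔ f z))           ≤⟨ +-mono-≤ (m≤m+n (suc (2 * (f x ⊔ f y))) (bump x y)) (m≤m+n (suc (2 * (f y ⊔ f z))) (bump y z)) ⟩
    height x y + height y z                                 ∎
    where
    open ≤-Reasoning
    lemma : ∀ p q → suc (2 * (p + q)) + 1 ≡ suc (2 * p) + suc (2 * q)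
    lemma = solve-∀
    M≤ : f x ⊔ f z ≤ (f x ⊔ f y) + (f y ⊔ f z)
    M≤ = ⊔-lub (≤-trans (m≤m⊔n (f x) (f y)) (m≤m+n _ _)) (≤-trans (m≤n⊔m (f y) (f z)) (m≤n+m _ _))

  -- By cases on which term attains each minimum on the right. Coinciding points are split off first
  -- because `height+2d` requires distinct ones; one mixed case is the mirror image of the other.
  low-tri : ∀ x y z → low x z ≤ low x y + low y z
  low-tri x y z with x Fin.≟ y | y Fin.≟ z
  ... | yes refl | _        = m≤n+m _ _
  ... | no _     | yes refl = m≤m+n _ _
  ... | no x≢y   | no y≢z with ⊓-sel (2 * d x y) (height x y) | ⊓-sel (2 * d y z) (height y z)
  ...   | inj₁ p | inj₁ q rewrite p | q = ≤-trans (low≤2d x z)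
            (≤-trans (*-monoʳ-≤ 2 (d-tri x y z)) (≤-reflexive (*-distribˡ-+ 2 (d x y) (d y z))))
  ...   | inj₂ p | inj₂ q rewrite p | q = ≤-trans (low≤height x z) (height+height x y z)
  ...   | inj₂ p | inj₁ q rewrite p | q = ≤-trans (low≤height x z) (height+2d x y z y≢z)
  ...   | inj₁ p | inj₂ q rewrite p | q = begin
    low x z                      ≡⟨ low-sym x z ⟩
    low z x                      ≤⟨ low≤height z x ⟩
    height z x                   ≤⟨ height+2d z y x (x≢y ∘ sym) ⟩
    height z y + 2 * d y x       ≡⟨ +-comm (height z y) _ ⟩
    2 * d y x + height z y       ≡⟨ cong₂ _+_ (cong (2 *_) (d-sym y x))
                                      (cong₂ (λ s t → suc (2 * s) + t) (⊔-comm (f z) (f y)) (bump-sym z y)) ⟩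
    2 * d x y + height y z       ∎
    where open ≤-Reasoning

  -- `E-tight` allows a distance up to 1 + max (f x) (f y), which is 1/2 above the unraised cap. The
  -- raise on `P` makes up exactly this difference.
  low-edge : ∀ x y → 1 ≤ E x y → low x y ≡ 2 * d x y
  low-edge x y h = m≤n⇒m⊓n≡m (begin
    2 * d x y                            ≤⟨ *-monoʳ-≤ 2 (E-tight x y h) ⟩
    2 * suc (f x ⊔ f y)                  ≡⟨ lemma (f x ⊔ f y) ⟩
    suc (2 * (f x ⊔ f y)) + 1            ≡⟨ cong (suc (2 * (f x ⊔ f y)) +_) (sym (𝟙-yes (P? x y) edge∈P)) ⟩
    height x y                           ∎)
    where
    open ≤-Reasoning
    lemma : ∀ p → 2 * suc p ≡ suc (2 * p) + 1
    lemma = solve-∀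
    at : ∀ z → d z z + f z ≤ f z
    at z = ≤-reflexive (cong (_+ f z) (d-refl z))
    edge∈P : P x y
    edge∈P with ≤-total (f x) (f y)
    ... | inj₁ le = inj₁ (le , y , h , at y)
    ... | inj₂ ge = inj₂ (ge , x , subst (1 ≤_) (E-sym x y) h , at x)

  Q⇒near : ∀ x y → Q x y → 1 ≤ near x y
  Q⇒near x y (_ , z , 1≤E , le) = ≤-trans
    (*-mono-≤ 1≤E (≤-reflexive (sym (𝟙-yes (d z y ≤? k′)
      (≤-trans (m≤m+n (d z y) (f y)) (≤-trans le (pot≤ d E z)))))))
    (term≤sum (λ z → E x z * 𝟙 (d z y ≤? k′)) z)

  low-typical : ∀ x y → x ≢ y → ¬ 1 ≤ f x → ¬ 1 ≤ f y → ¬ P x y → low x y ≡ 1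
  low-typical x y x≢y fx≱1 fy≱1 ¬p = ≤-antisym
    (≤-trans (low≤height x y) (≤-reflexive (cong₂ (λ s t → suc (2 * s) + t)
      (n<1⇒n≡0 (⊔-lub (≰⇒> fx≱1) (≰⇒> fy≱1))) (𝟙-no (P? x y) ¬p))))
    (low-pos x y x≢y)

  -- Exceptional pairs of the lower metric

  Y? : ∀ x y → Dec (low x y ≢ 1)
  Y? x y = ¬? (low x y ≟ 1)

  Y≤ : ∀ x y → 𝟙 (Y? x y) ≤ δ x y + (𝟙 (1 ≤? f x) + (𝟙 (1 ≤? f y) + (near x y + near y x)))
  Y≤ x y = 𝟙-bound (Y? x y) λ ≢1 → cases ≢1 (x Fin.≟ y) (1 ≤? f x) (1 ≤? f y) (P? x y)
    where
    cases : low x y ≢ 1 → (p : Dec (x ≡ y)) (q : Dec (1 ≤ f x)) (r : Dec (1 ≤ f y)) → Dec (P x y) →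
            1 ≤ 𝟙 p + (𝟙 q + (𝟙 r + (near x y + near y x)))
    cases ≢1 (yes _) q       r       _              = s≤s z≤n
    cases ≢1 (no _)  (yes _) r       _              = s≤s z≤n
    cases ≢1 (no _)  (no _)  (yes _) _              = s≤s z≤n
    cases ≢1 (no _)  (no _)  (no _)  (yes (inj₁ q)) = ≤-trans (Q⇒near x y q) (m≤m+n _ _)
    cases ≢1 (no _)  (no _)  (no _)  (yes (inj₂ q)) = ≤-trans (Q⇒near y x q) (m≤n+m _ (near x y))
    cases ≢1 (no x≢y) (no fx≱1) (no fy≱1) (no ¬p)   = ⊥-elim (≢1 (low-typical x y x≢y fx≱1 fy≱1 ¬p))

  Y-count : sum (λ x → sum (λ y → 𝟙 (Y? x y))) ≤ n + 2 * (n * high) + 2 * (total s * (2 * D) ^ k′)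
  Y-count = begin
    sum (λ x → sum (λ y → 𝟙 (Y? x y)))
      ≤⟨ sum-mono (λ x → sum-mono (Y≤ x)) ⟩
    ∑∑ (δ ⊞ (row ⊞ (column ⊞ (near ⊞ nearᵀ))))
      ≡⟨ trans (⊞-total δ (row ⊞ (column ⊞ (near ⊞ nearᵀ)))) (cong (∑∑ δ +_)
           (trans (⊞-total row (column ⊞ (near ⊞ nearᵀ))) (cong (∑∑ row +_)
             (trans (⊞-total column (near ⊞ nearᵀ)) (cong (∑∑ column +_) (⊞-total near nearᵀ)))))) ⟩
    ∑∑ δ + (∑∑ row + (∑∑ column + (∑∑ near + ∑∑ nearᵀ)))
      ≡⟨ cong₂ _+_ diagonal (cong₂ _+_ rows (cong₂ _+_ (sum-const n high) (cong (∑∑ near +_) (∑-comm nearᵀ)))) ⟩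
    n + (n * high + (n * high + (∑∑ near + ∑∑ near)))
      ≤⟨ +-monoʳ-≤ n (+-monoʳ-≤ (n * high) (+-monoʳ-≤ (n * high) (+-mono-≤ near-total near-total))) ⟩
    n + (n * high + (n * high + (N + N)))
      ≡⟨ lemma n (n * high) N ⟩
    n + 2 * (n * high) + 2 * N ∎
    where
    open ≤-Reasoning
    ∑∑ : Matrix n → ℕ
    ∑∑ A = sum (λ x → sum (A x))
    N : ℕ
    N = total s * (2 * D) ^ k′
    row column nearᵀ : Matrix n
    row x y = 𝟙 (1 ≤? f x)
    column x y = 𝟙 (1 ≤? f y)
    nearᵀ x y = near y x
    diagonal : ∑∑ δ ≡ n
    diagonal = trans (sum-cong-≗ {n} sum-δ) (trans (sum-const n 1) (*-identityʳ n))
    rows : ∑∑ row ≡ n * high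
    rows = trans (∑-comm row) (sum-const n high)
    lemma : ∀ p q r → p + (q + (q + (r + r))) ≡ p + 2 * q + 2 * r
    lemma = solve-∀

-- Rational metrics

-- frac c a is a / (c + 1).
frac : ℕ → ℕ → ℚ
frac c a = fromℚᵘ (mkℚᵘ (pos a) c)

frac-mono-≤ : ∀ c {a b} → a ≤ b → frac c a ≤ℚ frac c b
frac-mono-≤ c {a} {b} a≤b = ℚₚ.toℚᵘ-cancel-≤ (begin
  toℚᵘ (frac c a)  ≃⟨ ℚₚ.toℚᵘ-fromℚᵘ (mkℚᵘ (pos a) c) ⟩
  mkℚᵘ (pos a) c     ≤⟨ *≤* (ℤₚ.*-monoʳ-≤-nonNeg (pos (suc c)) (+≤+ a≤b)) ⟩
  mkℚᵘ (pos b) c     ≃⟨ ℚₚ.toℚᵘ-fromℚᵘ (mkℚᵘ (pos b) c) ⟨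
  toℚᵘ (frac c b)  ∎)
  where open ℚᵘₚ.≤-Reasoning

frac-mono-< : ∀ c {a b} → a < b → frac c a <ℚ frac c b
frac-mono-< c {a} {b} a<b = ℚₚ.toℚᵘ-cancel-< (begin-strict
  toℚᵘ (frac c a)  ≃⟨ ℚₚ.toℚᵘ-fromℚᵘ (mkℚᵘ (pos a) c) ⟩
  mkℚᵘ (pos a) c     <⟨ *<* (ℤₚ.*-monoʳ-<-pos (pos (suc c)) (+<+ a<b)) ⟩
  mkℚᵘ (pos b) c     ≃⟨ ℚₚ.toℚᵘ-fromℚᵘ (mkℚᵘ (pos b) c) ⟨
  toℚᵘ (frac c b)  ∎)
  where open ℚᵘₚ.≤-Reasoning

frac-zero : ∀ c → frac c 0 ≡ 0ℚ
frac-zero c = ℚₚ.0/n≡0 (suc c)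

frac-+ : ∀ c a b → frac c (a + b) ≡ frac c a +ℚ frac c b
frac-+ c a b = ℚₚ.toℚᵘ-injective (begin
  toℚᵘ (frac c (a + b))                  ≈⟨ ℚₚ.toℚᵘ-fromℚᵘ (mkℚᵘ (pos (a + b)) c) ⟩
  mkℚᵘ (pos (a + b)) c                     ≈⟨ *≡* (lemma (pos a) (pos b) (pos (suc c))) ⟩
  mkℚᵘ (pos a) c ℚᵘ.+ mkℚᵘ (pos b) c         ≈⟨ ℚᵘₚ.+-cong (ℚₚ.toℚᵘ-fromℚᵘ (mkℚᵘ (pos a) c)) (ℚₚ.toℚᵘ-fromℚᵘ (mkℚᵘ (pos b) c)) ⟨
  toℚᵘ (frac c a) ℚᵘ.+ toℚᵘ (frac c b)   ≈⟨ ℚₚ.toℚᵘ-homo-+ (frac c a) (frac c b) ⟨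
  toℚᵘ (frac c a +ℚ frac c b)            ∎)
  where
  open ℚᵘₚ.≃-Reasoning
  lemma : ∀ a b c → (a ℤ.+ b) ℤ.* (c ℤ.* c) ≡ (a ℤ.* c ℤ.+ b ℤ.* c) ℤ.* c
  lemma = ℤ-Solver.solve-∀

half-double : ∀ a → frac 1 (2 * a) ≡ toℚ a
half-double a = ℚₚ.fromℚᵘ-cong {mkℚᵘ (pos (2 * a)) 1} {mkℚᵘ (pos a) 0} 
  (*≡* (trans (sym (ℤₚ.pos-* (2 * a) 1)) (trans (cong pos (lemma a)) (ℤₚ.pos-* a 2))))
  where
  lemma : ∀ a → 2 * a * 1 ≡ a * 2
  lemma = solve-∀

frac-metric : ∀ {n} c (d : Matrix n) → (∀ x → d x x ≡ 0) → (∀ x y → x ≢ y → 1 ≤ d x y) →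
              (∀ x y → d x y ≡ d y x) → (∀ x y z → d x z ≤ d x y + d y z) →
              IsMetric n (λ x y → frac c (d x y))
frac-metric c d d-refl d-pos d-sym d-tri = record
  { diag      = λ x → trans (cong (frac c) (d-refl x)) (frac-zero c)
  ; positive  = λ x y x≢y → subst (_<ℚ frac c (d x y)) (frac-zero c) (frac-mono-< c (d-pos x y x≢y))
  ; symmetric = λ x y → cong (frac c) (d-sym x y)
  ; triangle  = λ x y z → subst (frac c (d x z) ≤ℚ_) (frac-+ c (d x y) (d y z)) (frac-mono-≤ c (d-tri x y z))
  }

frac-nonneg : ∀ c a → 0ℚ ≤ℚ frac c a
frac-nonneg c a = subst (_≤ℚ frac c a) (frac-zero c) (frac-mono-≤ c {0} {a} z≤n)

-- Cardinalities as finite sums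

sum-allFin : ∀ {n} (f : Fin n → ℕ) → sumᴸ (List.map f (allFin n)) ≡ sum f
sum-allFin f = trans (cong sumᴸ (Listₚ.map-tabulate id f)) (sum-tabulate f)
  where
  sum-tabulate : ∀ {n} (f : Fin n → ℕ) → sumᴸ (tabulate f) ≡ sum f
  sum-tabulate {zero}  f = refl
  sum-tabulate {suc n} f = cong (f zero +_) (sum-tabulate (f ∘ suc))

card≡sum : ∀ {n} (X : Fin n → Fin n → Bool) → card X ≡ sum (λ x → sum (λ y → if X x y then 1 else 0))
card≡sum {n} X = trans (sum-allFin (λ x → sumᴸ (List.map (row x) (allFin n)))) (sum-cong-≗ (λ x → sum-allFin (row x)))
  where
  row : Fin n → Fin n → ℕ
  row x y = if X x y then 1 else 0

-- The answer to one procedure and the sizes of its exceptional sets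

module Respond (k′ n m D : ℕ) (1≤D : 1 ≤ D) (Pair : Procedure n m) where
  open Game n k′ D
  open Play (play m Pair initial)
  open State final using (d; E; d-refl; d-pos; d-sym; d-tri; d-cap)
  open Counting n k′ D 1≤D final

  total≡2m : total final ≡ 2 * m
  total≡2m = trans count (cong (_+ 2 * m)
    (trans (sum-cong-≗ {n} (λ x → sum-replicate-zero n)) (sum-replicate-zero n)))

  suc-k : toℚ (suc k) ≡ toℚ (k + 1)
  suc-k = cong toℚ (sym (+-comm k 1))

  X? : ∀ x y → Dec (d x y ≤ k)
  X? x y = d x y ≤? k

  answers : Answer k n m Pair
  answers = record
    { p = p
    ; w = w
    ; w-range = w-range
    ; consistent = consistent
    ; dbar = λ x y → toℚ (d x y)
    ; dund = λ x y → frac 1 (low x y)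
    -- `toℚ` is `frac 0` definitionally; denominator 2 undoes the doubling in `low`.
    ; dbar-metric = frac-metric 0 d d-refl d-pos d-sym d-tri
    ; dund-metric = frac-metric 1 low low-refl low-pos low-sym low-tri
    ; dbar-range = λ x y → frac-nonneg 0 (d x y) , subst (toℚ (d x y) ≤ℚ_) suc-k (frac-mono-≤ 0 (d-cap x y))
    ; dund-range = λ x y → frac-nonneg 1 (low x y) ,
        subst (frac 1 (low x y) ≤ℚ_) (trans (half-double (suc k)) suc-k)
          (frac-mono-≤ 1 (≤-trans (low≤2d x y) (*-monoʳ-≤ 2 (d-cap x y))))
    ; dbar-edge = λ i → cong toℚ (answered i)
    ; dund-edge = λ i → trans (cong (frac 1) (trans (low-edge _ _ (asked i)) (cong (2 *_) (answered i))))
                          (half-double (w i))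
    ; X = λ x y → does (X? x y)
    ; X-spec = λ x y → far x y (X? x y)
    ; Y = λ x y → does (Y? x y)
    ; Y-spec = λ x y → half x y (low x y ≟ 1)
    }
    where
    far : ∀ x y (p : Dec (d x y ≤ k)) → does p ≡ false → toℚ (d x y) ≡ toℚ (k + 1)
    far x y (no d≰k) _ = trans (cong toℚ (≤-antisym (d-cap x y) (≰⇒> d≰k))) suc-k
    half : ∀ x y (p : Dec (low x y ≡ 1)) → does (¬? p) ≡ false → frac 1 (low x y) ≡ ½
    half x y (yes low≡1) _ = cong (frac 1) low≡1

  card-X : card (Answer.X answers) ≤ n * (2 * D) ^ k + k * (2 * m)
  card-X = begin
    card (Answer.X answers)                ≡⟨ card≡sum (Answer.X answers) ⟩
    sum (λ x → ball x k)                   ≤⟨ close-pairs ⟩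
    n * (2 * D) ^ k + k * total final      ≡⟨ cong (λ t → n * (2 * D) ^ k + k * t) total≡2m ⟩
    n * (2 * D) ^ k + k * (2 * m)          ∎
    where open ≤-Reasoning

  card-Y : ∃[ h ] (D * h ≤ 2 ^ k′ * (2 * m) × card (Answer.Y answers) ≤ n + 2 * (n * h) + 2 * (2 * m * (2 * D) ^ k′))
  card-Y = high , subst (λ t → D * high ≤ 2 ^ k′ * t) total≡2m high≤ , (begin
    card (Answer.Y answers)                                         ≡⟨ card≡sum (Answer.Y answers) ⟩
    sum (λ x → sum (λ y → 𝟙 (Y? x y)))                              ≤⟨ Y-count ⟩
    n + 2 * (n * high) + 2 * (total final * (2 * D) ^ k′)           ≡⟨ cong (λ t → n + 2 * (n * high) + 2 * (t * (2 * D) ^ k′)) total≡2m ⟩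
    n + 2 * (n * high) + 2 * (2 * m * (2 * D) ^ k′)                 ∎)
    where open ≤-Reasoning

-- Asymptotics

square-cancel-≤ : ∀ {x y} → x * x ≤ y * y → x ≤ y
square-cancel-≤ h = ≮⇒≥ λ y<x → <⇒≱ (*-mono-< y<x y<x) h

^-cancelˡ-≤ : ∀ k′ {x y} → x ^ suc k′ ≤ y ^ suc k′ → x ≤ y
^-cancelˡ-≤ k′ h = ≮⇒≥ λ y<x → <⇒≱ (^-monoˡ-< (suc k′) y<x) h

x≤x^suc : ∀ k′ x → x ≤ x ^ suc k′
x≤x^suc k′ zero    = z≤n
x≤x^suc k′ (suc x) = m≤m*n (suc x) (suc x ^ k′) {{m^n≢0 (suc x) k′}}

-- Downward search from a known witness. Only the failure immediately below the value found is
-- recorded, which is what the estimate of the scale uses.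
least-suc : ∀ {P : ℕ → Set} → Decidable P → ∀ N → P (suc N) → ∃[ j ] (P (suc j) × (j ≡ 0 ⊎ ¬ P j))
least-suc P? zero    p = 0 , p , inj₁ refl
least-suc P? (suc N) p with P? (suc N)
... | yes q = least-suc P? N q
... | no ¬q = suc N , p , inj₂ ¬q

module Scale (k′ : ℕ) where

  k : ℕ
  k = suc k′

  -- For positive `n` this is D² ≥ (m / n) n^(1/k), cleared of denominators and roots.
  Large : ℕ → ℕ → ℕ → Set
  Large n m D = m ^ k * n ≤ (D * D * n) ^ k

  large-suc : ∀ n m → Large n m (suc m)
  large-suc n m = begin
    m ^ k * n                   ≤⟨ *-monoʳ-≤ (m ^ k) (x≤x^suc k′ n) ⟩
    m ^ k * n ^ k               ≡⟨ sym (^-distrib-* m n k) ⟩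
    (m * n) ^ k                 ≤⟨ ^-monoˡ-≤ k (*-monoˡ-≤ n (≤-trans (n≤1+n m) (m≤m*n (suc m) (suc m)))) ⟩
    (suc m * suc m * n) ^ k     ∎
    where open ≤-Reasoning

  -- Least D ≥ 1 with D² ≥ (m / n) n^{1/k}: the geometric mean of m / n and n^{1/k},
  -- so that it is o(n^{1/k}) while m = o(n D).
  least : ∀ n m → ∃[ j ] (Large n m (suc j) × (j ≡ 0 ⊎ ¬ Large n m j))
  least n m = least-suc (λ D → m ^ k * n ≤? (D * D * n) ^ k) m (large-suc n m)

  scale : ℕ → ℕ → ℕ
  scale n m = suc (proj₁ (least n m))

  module _ (m : ℕ → ℕ) (sub : SubCritical k m) where

    -- Multiply the hypothesis for the constant c², (c² m)^k ≤ n^(k+1), by m^k and use m^k n ≤ (D²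
    -- n)^k: the outcome is (c m)^(2k) ≤ (n D)^(2k).
    m-small : ∀ c → 0 < c → ∃[ N ] (∀ n → N ≤ n → c * m n ≤ n * scale n (m n))
    m-small c 0<c with sub (c * c) (*-mono-< 0<c 0<c)
    ... | N , h = N , λ n N≤n → small n (m n) (h n N≤n)
      where
      small : ∀ n m → (c * c * m) ^ k ≤ n ^ (k + 1) → c * m ≤ n * scale n m
      small n m hyp = square-cancel-≤ (^-cancelˡ-≤ k′ (begin
        (c * m * (c * m)) ^ k           ≡⟨ cong (_^ k) (lemma₁ c m) ⟩
        (c * c * m * m) ^ k             ≡⟨ ^-distrib-* (c * c * m) m k ⟩
        (c * c * m) ^ k * m ^ k         ≤⟨ *-monoˡ-≤ (m ^ k) hyp ⟩
        n ^ (k + 1) * m ^ k             ≡⟨ cong (λ t → n ^ t * m ^ k) (+-comm k 1) ⟩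
        n * n ^ k * m ^ k               ≡⟨ lemma₂ n (n ^ k) (m ^ k) ⟩
        n ^ k * (m ^ k * n)             ≤⟨ *-monoʳ-≤ (n ^ k) (proj₁ (proj₂ (least n m))) ⟩
        n ^ k * (D * D * n) ^ k         ≡⟨ sym (^-distrib-* n (D * D * n) k) ⟩
        (n * (D * D * n)) ^ k           ≡⟨ cong (_^ k) (lemma₃ n D) ⟩
        (n * D * (n * D)) ^ k           ∎))
        where
        open ≤-Reasoning
        D : ℕ
        D = scale n m
        lemma₁ : ∀ c m → c * m * (c * m) ≡ c * c * m * m
        lemma₁ = solve-∀
        lemma₂ : ∀ a b c → a * b * c ≡ b * (c * a)
        lemma₂ = solve-∀
        lemma₃ : ∀ n D → n * (D * D * n) ≡ n * D * (n * D)
        lemma₃ = solve-∀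

    -- If D = j + 1 with j ≥ 1, then D ≤ 2 j, while `j` is not large, so (j² n)^k ≤ m^k n. Combined
    -- with the hypothesis for the constant (2c)² this bounds (2 c j)^(2k) by n².
    scale-small : ∀ c → 0 < c → ∃[ N ] (∀ n → N ≤ n → (c * scale n (m n)) ^ k ≤ n)
    scale-small c 0<c with sub (2 * c * (2 * c)) (*-mono-< 0<2c 0<2c)
      where
      0<2c : 0 < 2 * c
      0<2c = ≤-trans 0<c (m≤n*m c 2)
    -- The threshold c^k settles the case D = 1 and makes `n` positive, so that n^k can be
    -- cancelled.
    ... | N , h = N ⊔ c ^ k , λ n le →
        small n (m n) (h n (≤-trans (m≤m⊔n N (c ^ k)) le)) (≤-trans (m≤n⊔m N (c ^ k)) le)
      where
      small : ∀ n m → (2 * c * (2 * c) * m) ^ k ≤ n ^ (k + 1) → c ^ k ≤ n → (c * scale n m) ^ k ≤ n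
      small n m hyp c^k≤n with least n m
      ... | j , _ , inj₁ refl = ≤-trans (≤-reflexive (cong (_^ k) (*-identityʳ c))) c^k≤n
      ... | zero , _ , inj₂ _ = ≤-trans (≤-reflexive (cong (_^ k) (*-identityʳ c))) c^k≤n
      ... | j@(suc j′) , _ , inj₂ ¬large = ≤-trans
          (^-monoˡ-≤ k (≤-trans (*-monoʳ-≤ c (+-monoˡ-≤ j (s≤s z≤n))) (≤-reflexive (lemma₀ c j))))
          (square-cancel-≤ (*-cancelʳ-≤ (T * T) (n * n) (n ^ k) {{m^n≢0 n k {{>-nonZero 1≤n}}}} (begin
            T * T * n ^ k                                   ≡⟨ cong (_* n ^ k) (sym (^-distrib-* (2 * c * j) (2 * c * j) k)) ⟩
            (2 * c * j * (2 * c * j)) ^ k * n ^ k           ≡⟨ sym (^-distrib-* (2 * c * j * (2 * c * j)) n k) ⟩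
            (2 * c * j * (2 * c * j) * n) ^ k               ≡⟨ cong (_^ k) (lemma₁ (2 * c) j n) ⟩
            (2 * c * (2 * c) * (j * j * n)) ^ k             ≡⟨ ^-distrib-* (2 * c * (2 * c)) (j * j * n) k ⟩
            (2 * c * (2 * c)) ^ k * (j * j * n) ^ k         ≤⟨ *-monoʳ-≤ ((2 * c * (2 * c)) ^ k) (≰⇒≥ ¬large) ⟩
            (2 * c * (2 * c)) ^ k * (m ^ k * n)             ≡⟨ sym (*-assoc ((2 * c * (2 * c)) ^ k) (m ^ k) n) ⟩
            (2 * c * (2 * c)) ^ k * m ^ k * n               ≡⟨ cong (_* n) (sym (^-distrib-* (2 * c * (2 * c)) m k)) ⟩
            (2 * c * (2 * c) * m) ^ k * n                   ≤⟨ *-monoˡ-≤ n hyp ⟩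
            n ^ (k + 1) * n                                 ≡⟨ cong (λ t → n ^ t * n) (+-comm k 1) ⟩
            n * n ^ k * n                                   ≡⟨ lemma₂ n (n ^ k) ⟩
            n * n * n ^ k                                   ∎)))
        where
        open ≤-Reasoning
        T : ℕ
        T = (2 * c * j) ^ k
        1≤n : 1 ≤ n
        1≤n = ≤-trans (≤-trans 0<c (x≤x^suc k′ c)) c^k≤n
        lemma₀ : ∀ c j → c * (j + j) ≡ 2 * c * j
        lemma₀ = solve-∀
        lemma₁ : ∀ c j n → c * j * (c * j) * n ≡ c * c * (j * j * n)
        lemma₁ = solve-∀
        lemma₂ : ∀ a b → a * b * a ≡ a * a * b
        lemma₂ = solve-∀

-- Sizes of the exceptional sets against n² for a single n

module Bounds (k′ c n m D : ℕ) (0<c : 0 < c) (1≤D : 1 ≤ D) where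

  k : ℕ
  k = suc k′

  instance
    D≢0 : NonZero D
    D≢0 = >-nonZero 1≤D

  D^k≤ : ∀ c′ → 0 < c′ → (c′ * D) ^ k ≤ n → D ^ k ≤ n
  D^k≤ c′ 0<c′ h = ≤-trans (^-monoˡ-≤ k (m≤n*m D c′ {{>-nonZero 0<c′}})) h

  -- Each of the two terms gets half of n²: the balls because (2D)^k is small against `n`, the
  -- degrees because `m` is small against n D and D ≤ n.
  X-bound : (4 * c * D) ^ k ≤ n → 4 * c * k * m ≤ n * D → c * (n * (2 * D) ^ k + k * (2 * m)) ≤ n ^ 2
  X-bound hD hm = *-cancelˡ-≤ 2 (begin
    2 * (c * (n * (2 * D) ^ k + k * (2 * m)))       ≡⟨ lemma₁ c n ((2 * D) ^ k) k m ⟩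
    n * (2 * c * (2 * D) ^ k) + 4 * c * k * m       ≤⟨ +-mono-≤ (*-monoʳ-≤ n first) (≤-trans hm (*-monoʳ-≤ n D≤n)) ⟩
    n * n + n * n                                   ≡⟨ lemma₂ n ⟩
    2 * n ^ 2                                       ∎)
    where
    open ≤-Reasoning
    lemma₁ : ∀ c n p k m → 2 * (c * (n * p + k * (2 * m))) ≡ n * (2 * c * p) + 4 * c * k * m
    lemma₁ = solve-∀
    lemma₂ : ∀ n → n * n + n * n ≡ 2 * (n * (n * 1))
    lemma₂ = solve-∀
    lemma₃ : ∀ c D → 2 * c * (2 * D) ≡ 4 * c * D
    lemma₃ = solve-∀
    first : 2 * c * (2 * D) ^ k ≤ n
    first = begin
      2 * c * (2 * D) ^ k         ≤⟨ *-monoˡ-≤ ((2 * D) ^ k) (x≤x^suc k′ (2 * c)) ⟩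
      (2 * c) ^ k * (2 * D) ^ k   ≡⟨ sym (^-distrib-* (2 * c) (2 * D) k) ⟩
      (2 * c * (2 * D)) ^ k       ≡⟨ cong (_^ k) (lemma₃ c D) ⟩
      (4 * c * D) ^ k             ≤⟨ hD ⟩
      n                           ∎
    D≤n : D ≤ n
    D≤n = ≤-trans (x≤x^suc k′ D) (D^k≤ (4 * c) (≤-trans 0<c (m≤n*m c 4)) hD)

  -- Each of the three terms gets a third of n². The bound on D h against n D makes `h` small
  -- against `n`, and m D^k′ is small against n D^k, which is at most n².
  Y-bound : ∀ h → 3 * c ≤ n → (1 * D) ^ k ≤ n → 12 * c * 2 ^ k′ * m ≤ n * D → D * h ≤ 2 ^ k′ * (2 * m) →
            c * (n + 2 * (n * h) + 2 * (2 * m * (2 * D) ^ k′)) ≤ n ^ 2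
  Y-bound h hc hD hm hh = *-cancelˡ-≤ 3 (begin
    3 * (c * (n + 2 * (n * h) + 2 * (2 * m * (2 * D) ^ k′)))     ≡⟨ lemma₁ c n h m ((2 * D) ^ k′) ⟩
    n * (3 * c) + n * (6 * c * h) + 12 * c * m * (2 * D) ^ k′    ≤⟨ +-mono-≤ (+-mono-≤ (*-monoʳ-≤ n hc) (*-monoʳ-≤ n second)) third ⟩
    n * n + n * n + n * n                                        ≡⟨ lemma₂ n ⟩
    3 * n ^ 2                                                    ∎)
    where
    open ≤-Reasoning
    lemma₁ : ∀ c n h m p → 3 * (c * (n + 2 * (n * h) + 2 * (2 * m * p))) ≡ n * (3 * c) + n * (6 * c * h) + 12 * c * m * p
    lemma₁ = solve-∀
    lemma₂ : ∀ n → n * n + n * n + n * n ≡ 3 * (n * (n * 1))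
    lemma₂ = solve-∀
    lemma₃ : ∀ c h D → 6 * c * h * D ≡ 6 * c * (D * h)
    lemma₃ = solve-∀
    lemma₄ : ∀ c p m → 6 * c * (p * (2 * m)) ≡ 12 * c * p * m
    lemma₄ = solve-∀
    lemma₅ : ∀ c m p q → 12 * c * m * (p * q) ≡ 12 * c * p * m * q
    lemma₅ = solve-∀
    second : 6 * c * h ≤ n
    second = *-cancelʳ-≤ (6 * c * h) n D (begin
      6 * c * h * D                   ≡⟨ lemma₃ c h D ⟩
      6 * c * (D * h)                 ≤⟨ *-monoʳ-≤ (6 * c) hh ⟩
      6 * c * (2 ^ k′ * (2 * m))      ≡⟨ lemma₄ c (2 ^ k′) m ⟩
      12 * c * 2 ^ k′ * m             ≤⟨ hm ⟩
      n * D                           ∎)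
    third : 12 * c * m * (2 * D) ^ k′ ≤ n * n
    third = begin
      12 * c * m * (2 * D) ^ k′            ≡⟨ cong (12 * c * m *_) (^-distrib-* 2 D k′) ⟩
      12 * c * m * (2 ^ k′ * D ^ k′)       ≡⟨ lemma₅ c m (2 ^ k′) (D ^ k′) ⟩
      12 * c * 2 ^ k′ * m * D ^ k′         ≤⟨ *-monoˡ-≤ (D ^ k′) hm ⟩
      n * D * D ^ k′                       ≡⟨ *-assoc n D (D ^ k′) ⟩
      n * D ^ k                            ≤⟨ *-monoʳ-≤ n (D^k≤ 1 (s≤s z≤n) hD) ⟩
      n * n                                ∎

-- Assembling the answers for all n and the o(n²) estimates

theorem7p4 : (k : ℕ) → 1 ≤ k → (m : ℕ → ℕ) → (Pair : (n : ℕ) → Procedure n (m n)) → SubCritical k m →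
    Σ[ A ∈ ((n : ℕ) → Answer k n (m n) (Pair n)) ]
    (LittleO (λ n → card (Answer.X (A n))) (λ n → n ^ 2) × LittleO (λ n → card (Answer.Y (A n))) (λ n → n ^ 2))
theorem7p4 (suc k′) _ m Pair sub = (λ n → answers n) , X-small , Y-small
  where
  open Scale k′
  -- The scale depends only on `n` and the number of queries, so it is fixed before the game starts
  -- and is the same for every constant c.
  D : ℕ → ℕ
  D n = scale n (m n)
  module R n = Respond k′ n (m n) (D n) (s≤s z≤n) (Pair n)
  open R using (answers; card-X; card-Y)

  X-small : LittleO (λ n → card (Answer.X (answers n))) (λ n → n ^ 2)
  X-small c 0<c =
    let N₁ , hD = scale-small m sub (4 * c) (*-mono-< {0} {4} {0} (s≤s z≤n) 0<c)
        N₂ , hm = m-small m sub (4 * c * k) (*-mono-< {0} {4 * c} {0} (*-mono-< {0} {4} {0} (s≤s z≤n) 0<c) (s≤s z≤n))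
    in N₁ ⊔ N₂ , λ n le → ≤-trans (*-monoʳ-≤ c (card-X n))
      (Bounds.X-bound k′ c n (m n) (D n) 0<c (s≤s z≤n)
        (hD n (≤-trans (m≤m⊔n N₁ N₂) le)) (hm n (≤-trans (m≤n⊔m N₁ N₂) le)))

  Y-small : LittleO (λ n → card (Answer.Y (answers n))) (λ n → n ^ 2)
  Y-small c 0<c =
    let N₁ , hD = scale-small m sub 1 (s≤s z≤n)
        N₂ , hm = m-small m sub (12 * c * 2 ^ k′)
                    (*-mono-< {0} {12 * c} {0} (*-mono-< {0} {12} {0} (s≤s z≤n) 0<c) (m^n>0 2 k′))
    in 3 * c ⊔ (N₁ ⊔ N₂) , λ n le →
      let h , hh , hY = card-Y n
          le′ = ≤-trans (m≤n⊔m (3 * c) (N₁ ⊔ N₂)) le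
      in ≤-trans (*-monoʳ-≤ c hY)
        (Bounds.Y-bound k′ c n (m n) (D n) 0<c (s≤s z≤n) h
          (≤-trans (m≤m⊔n (3 * c) (N₁ ⊔ N₂)) le)
          (hD n (≤-trans (m≤m⊔n N₁ N₂) le′)) (hm n (≤-trans (m≤n⊔m N₁ N₂) le′)) hh)
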